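{- For every tree in $\mathcal{F}^{(n\ldots 1)}$, its Goulden-Yong Dual is the same labeled graph as its dual.
   Context: $\mathbf{S}_n$ is the symmetric group on $[n]=\{1,\ldots,n\}$; permutations are multiplied from left to right (in $p\cdot q$, $p$ is applied first). A transposition sequence over $\mathbf{S}_n$ is a finite sequence $\langle s_1,\ldots,s_m\rangle$ of transpositions, with product $s_1\cdots s_m$; it is identified with the labeled graph on vertex set $[n]$ having, for each $s_i=(x_i,y_i)$, an edge labeled $i$ between $x_i$ and $y_i$. $\mathcal{F}^{(n\ldots 1)}$ is the set of length $n-1$ transposition sequences over $\mathbf{S}_n$ whose product is the cycle $(n,\ldots,2,1)$ (mapping $n\mapsto n-1\mapsto\cdots\mapsto 1\mapsto n$); their graphs are trees (Dénes). Dual (Trail Dual, which equals the Mind-Body Dual): in a labeled graph $G$ (vertices labeled by $[n]$, edges labeled bijectively by $[m]$), for a vertex $u$ the Minimal Increasing Greedy Trail $T_u$ is the trail (no repeated edges) starting at $u$ that at each step takes, among the edges incident to the current vertex whose labels are larger than those of all previously used edges, the one with the smallest label, and stops when there is no such edge. Each edge is used by exactly two of these trails. The dual of $G$ is the labeled graph on the same vertex set in which, for each label $k$, there is an edge labeled $k$ between the two vertices $x,y$ such that $T_x$ and $T_y$ both use the edge of $G$ labeled $k$. Circle Chord Diagram of a labeled tree on $n$ vertices: a circle with $n$ distinct points on it labeled $1,\ldots,n$ in clockwise order, with a chord between $x$ and $y$, carrying the edge label, for each edge $\{x,y\}$ of the tree. For a tree in $\mathcal{F}^{(n\ldots 1)}$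 the chords are non-crossing, i.e. any two meet at most at a point on the circle (Goulden–Yong). The $n$ points divide the circle into $n$ arcs: for $2\le k\le n$, arc $k$ is the arc between $k-1$ and $k$, and arc $1$ is the arc between $n$ and $1$. The chords divide the disk into $n$ regions, each containing exactly one of the arcs; the region containing arc $k$ is region $k$. Goulden-Yong Dual of a tree in $\mathcal{F}^{(n\ldots 1)}$: the labeled graph with one vertex for each region of its Circle Chord Diagram, the vertex of region $k$ being labeled $k$, and with an edge between two vertices whenever their regions have a chord in common on their boundaries, that edge getting the label of the chord. -}

module Defs where

open import Algebra.Bundles using (CommutativeRing)
open import Data.Fin.Base using (Fin; zero; suc; inject₁; fromℕ; _<_; _≤_)
open import Data.Fin.Permutation
  using (Permutation′; id; transpose; _∘ₚ_; _⟨$⟩ʳ_)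
open import Data.List.Base using (List; []; _∷_)
open import Data.List.Membership.Propositional using (_∈_)
open import Data.List.Relation.Unary.All using (All)
open import Data.Nat.Base using (ℕ; suc)
open import Data.Product.Base using (_×_; _,_; ∃-syntax)
open import Data.Sum.Base using (_⊎_)
open import Data.Vec.Base using (Vec; foldr′; lookup)
open import Function.Bundles using (_⇔_)
open import Level using (Level; _⊔_; 0ℓ) renaming (suc to lsuc)
open import Relation.Binary.Core using (Rel)
open import Relation.Binary.Construct.Closure.ReflexiveTransitive using (Star)
open import Relation.Binary.PropositionalEquality.Core using (_≡_; _≢_)
open import Relation.Binary.Structures using (IsStrictTotalOrder)
import Relation.Binary.Construct.StrictToNonStrict as ToNonStrict
open import Relation.Nullary.Negation.Core using (¬_)

------------------------------------------------------------------------
-- Labelled graphs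

-- The elements 1, …, n of [n] are represented by 0, …, n-1 in Fin n, for
-- vertices as well as for edge labels; the order is unchanged.
--
-- `G k x y` means that G has an edge labelled k between x and y.

LabelledGraph : ℕ → ℕ → (ℓ : Level) → Set (lsuc ℓ)
LabelledGraph n m ℓ = Fin m → Fin n → Fin n → Set ℓ

infix 4 _≐_

_≐_ : ∀ {n m ℓ ℓ′} → LabelledGraph n m ℓ → LabelledGraph n m ℓ′ → Set (ℓ ⊔ ℓ′)
G ≐ H = ∀ k x y → G k x y ⇔ H k x y

------------------------------------------------------------------------
-- Transposition sequences

record Transposition (n : ℕ) : Set where
  constructor mkTransposition
  field
    x y : Fin n
    x≢y : x ≢ y

toPermutation : ∀ {n} → Transposition n → Permutation′ n
toPermutation s = transpose x y
  where open Transposition s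

-- `π ∘ₚ ρ` applies π first, so this is the left-to-right product.

product : ∀ {n m} → Vec (Transposition n) m → Permutation′ n
product = foldr′ (λ s π → toPermutation s ∘ₚ π) id

graph : ∀ {n m} → Vec (Transposition n) m → LabelledGraph n m 0ℓ
graph s k u v = (u ≡ x × v ≡ y) ⊎ (u ≡ y × v ≡ x)
  where open Transposition (lookup s k)

-- The cycle (n, …, 2, 1).

prev : ∀ {m} → Fin (suc m) → Fin (suc m)
prev {m} zero    = fromℕ m
prev     (suc i) = inject₁ i

-- Membership in 𝓕^(n…1), where n = suc m.

In𝓕 : ∀ {m} → Vec (Transposition (suc m)) m → Set
In𝓕 s = ∀ i → product s ⟨$⟩ʳ i ≡ prev i

------------------------------------------------------------------------
-- The (trail) dual

module Trails {n m ℓ} (G : LabelledGraph n m ℓ) where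

  -- Below, `used` lists the labels of the edges already traversed (most
  -- recent first), and v is the current vertex.

  Available : List (Fin m) → Fin n → Fin m → Set ℓ
  Available used v k = (∃[ w ] G k v w) × All (_< k) used

  data GreedyFrom (used : List (Fin m)) (v : Fin n) : List (Fin m) → Set ℓ where
    stop : (∀ k → ¬ Available used v k) → GreedyFrom used v []
    step : ∀ {k w ks} →
           Available used v k →
           (∀ j → Available used v j → k ≤ j) →
           G k v w →
           GreedyFrom (k ∷ used) w ks →
           GreedyFrom used v (k ∷ ks)

  -- ks is the list of labels along T u.

  MinimalIncreasingGreedyTrail : Fin n → List (Fin m) → Set ℓ
  MinimalIncreasingGreedyTrail u ks = GreedyFrom [] u ks

  TrailUses : Fin n → Fin m → Set ℓ
  TrailUses u k = ∃[ ks ] MinimalIncreasingGreedyTrail u ks × k ∈ ks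

dual : ∀ {n m ℓ} → LabelledGraph n m ℓ → LabelledGraph n m ℓ
dual G k x y = x ≢ y × TrailUses x k × TrailUses y k
  where open Trails G

------------------------------------------------------------------------
-- Plane geometry over an ordered field

-- The library has no real numbers. Circle chord diagrams are therefore
-- drawn in the coordinate plane over an arbitrary (totally) ordered field,
-- of which ℝ is, classically, an example.

record OrderedField c ℓ₁ ℓ₂ : Set (lsuc (c ⊔ ℓ₁ ⊔ ℓ₂)) where
  infix 4 _≺_
  field
    commutativeRing : CommutativeRing c ℓ₁
  open CommutativeRing commutativeRing public
  field
    _≺_                : Rel Carrier ℓ₂
    isStrictTotalOrder : IsStrictTotalOrder _≈_ _≺_
    0≺1                : 0# ≺ 1#
    +-monoˡ-≺          : ∀ {a b} c → a ≺ b → a + c ≺ b + c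
    *-positive         : ∀ {a b} → 0# ≺ a → 0# ≺ b → 0# ≺ a * b
    inverse            : ∀ {a} → ¬ (a ≈ 0#) → ∃[ b ] a * b ≈ 1#
  open ToNonStrict _≈_ _≺_ public using () renaming (_≤_ to _≼_)

module Plane {c ℓ₁ ℓ₂} (K : OrderedField c ℓ₁ ℓ₂) where
  open OrderedField K

  Point : Set c
  Point = Carrier × Carrier

  infix 4 _≋_

  _≋_ : Rel Point ℓ₁
  (a , b) ≋ (a′ , b′) = a ≈ a′ × b ≈ b′

  ∥_∥² : Point → Carrier
  ∥ a , b ∥² = a * a + b * b

  OnCircle : Point → Set ℓ₁
  OnCircle p = ∥ p ∥² ≈ 1#

  InDisk : Point → Set (ℓ₁ ⊔ ℓ₂)
  InDisk p = ∥ p ∥² ≼ 1#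

  -- The cross product (q - p) × (r - p), negative exactly when p, q, r is a
  -- clockwise turn. For p, q, r on the circle this says that they are
  -- distinct and are met in this cyclic order when going round clockwise.

  orient : Point → Point → Point → Carrier
  orient (p₁ , p₂) (q₁ , q₂) (r₁ , r₂) =
    (q₁ - p₁) * (r₂ - p₂) - (q₂ - p₂) * (r₁ - p₁)

  Clockwise : Point → Point → Point → Set ℓ₂
  Clockwise p q r = orient p q r ≺ 0#

  along : Point → Point → Carrier → Point
  along (p₁ , p₂) (q₁ , q₂) t =
    (1# - t) * p₁ + t * q₁ , (1# - t) * p₂ + t * q₂

  Segment : Point → Point → Point → Set (c ⊔ ℓ₁ ⊔ ℓ₂)
  Segment p q z = ∃[ t ] 0# ≼ t × t ≼ 1# × z ≋ along p q t

  Near : Carrier → Point → Point → Set ℓ₂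
  Near ε (a , b) (a′ , b′) =
    (a - ε ≺ a′ × a′ ≺ a + ε) × (b - ε ≺ b′ × b′ ≺ b + ε)

  Boundary : ∀ {ℓ} → (Point → Set ℓ) → Point → Set (c ⊔ ℓ₂ ⊔ ℓ)
  Boundary R z = ∀ ε → 0# ≺ ε →
    (∃[ w ] Near ε z w × R w) × (∃[ w ] Near ε z w × ¬ R w)

  -- The open arc going clockwise from p to q; if p and q coincide it is the
  -- whole circle without that point (needed for n = 1 only).

  Arc : Point → Point → Point → Set (ℓ₁ ⊔ ℓ₂)
  Arc p q z = OnCircle z × ¬ (z ≋ p) × ¬ (z ≋ q) × (¬ (p ≋ q) → Clockwise p z q)

  record CirclePoints (n : ℕ) : Set (c ⊔ ℓ₁ ⊔ ℓ₂) where
    field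
      point     : Fin n → Point
      onCircle  : ∀ i → OnCircle (point i)
      distinct  : ∀ {i j} → i ≢ j → ¬ (point i ≋ point j)
      clockwise : ∀ {i j k} → i < j → j < k →
                  Clockwise (point i) (point j) (point k)

------------------------------------------------------------------------
-- Circle chord diagrams and the Goulden–Yong dual

module ChordDiagram {c ℓ₁ ℓ₂} (K : OrderedField c ℓ₁ ℓ₂) {m : ℕ}
                    (P : Plane.CirclePoints K (suc m))
                    {l ℓ} (G : LabelledGraph (suc m) l ℓ) where
  open OrderedField K
  open Plane K
  open CirclePoints P

  OnChord : Fin l → Point → Set (c ⊔ ℓ₁ ⊔ ℓ₂ ⊔ ℓ)
  OnChord e z = ∃[ x ] ∃[ y ] G e x y × Segment (point x) (point y) z

  OffChords : Point → Set (c ⊔ ℓ₁ ⊔ ℓ₂ ⊔ ℓ)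
  OffChords z = InDisk z × (∀ e → ¬ OnChord e z)

  -- The regions are the connected components of the disk minus the chords.
  -- This set is relatively open in a convex set, so its components are its
  -- classes under being joined by polygonal paths.

  Visible : Rel Point (c ⊔ ℓ₁ ⊔ ℓ₂ ⊔ ℓ)
  Visible z w = ∀ v → Segment z w v → OffChords v

  Joined : Rel Point (c ⊔ ℓ₁ ⊔ ℓ₂ ⊔ ℓ)
  Joined = Star Visible

  arc : Fin (suc m) → Point → Set (ℓ₁ ⊔ ℓ₂)
  arc k = Arc (point (prev k)) (point k)

  Region : Fin (suc m) → Point → Set (c ⊔ ℓ₁ ⊔ ℓ₂ ⊔ ℓ)
  Region k z = OffChords z × (∃[ a ] arc k a × Joined a z)

  ChordOnBoundary : Fin l → Fin (suc m) → Set (c ⊔ ℓ₁ ⊔ ℓ₂ ⊔ ℓ)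
  ChordOnBoundary e k = ∀ z → OnChord e z → Boundary (Region k) z

  -- Each region contains exactly one arc, so distinct labels stand for
  -- distinct regions.

  gouldenYongDual : LabelledGraph (suc m) l (c ⊔ ℓ₁ ⊔ ℓ₂ ⊔ ℓ)
  gouldenYongDual e x y = x ≢ y × ChordOnBoundary e x × ChordOnBoundary e y

{-# OPTIONS --safe #-}

-- Geometry. A chord is the intersection of the disk with the line through its
-- ends, so two points off the chords lie in one region iff no chord has them
-- on different sides. Hence chord e is on the boundary of region u iff no
-- chord f has an end of e strictly on the side of f not containing arc u.
--
-- Combinatorics. Following the product s₁ ⋯ sₘ letter by letter shows that
-- the trail of u is the walk of u under the prefixes of the product; it ends
-- at prev u. Let sⱼ = (a b) with a < b. Moving sⱼ to the front leaves n-2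
-- transpositions whose product has the cycles [a, b) and its complement, and
-- n-2 edges cannot connect n vertices, so none of them leaves these two sets.
-- It follows that a trail using edge k ≠ j has both ends of edge k on the side
-- of chord j that contains arc u. Conversely, if both ends of edge k are
-- on u's side of every chord, let w be the start of the trail that uses edge
-- k and has arc w on the same side of chord k as arc u. A chord
-- between arcs u and w would have both ends of k as its own ends, so there is
-- none, and then the interval between u and w is a union of components of the
-- graph, i.e. u = w.

module Submission where

open import Defs
open import Algebra.Bundles using (RawRing)
open import Algebra.Solver.Ring.AlmostCommutativeRing
  using (fromCommutativeRing; _-Raw-AlmostCommutative⟶_)
open import Data.Bool.Base using (Bool; true; false)
open import Data.Empty using (⊥-elim)
open import Data.Fin.Base as Fin
  using (Fin; zero; suc; toℕ; fromℕ; fromℕ<; inject₁; punchIn; punchOut)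
open import Data.Fin.Induction using (<-weakInduction)
open import Data.Fin.Permutation using (_⟨$⟩ʳ_)
open import Data.Fin.Properties
  using (toℕ-inject₁; toℕ-fromℕ; toℕ-fromℕ<; toℕ-injective; toℕ<n; toℕ≤pred[n]; <-cmp; _≟_; _≤?_; _<?_;
         punchOut-cong; punchOut-punchIn; punchIn-punchOut; punchInᵢ≢i)
open import Data.Integer.Base as ℤ using (ℤ; +_; -[1+_]; 0ℤ; 1ℤ)
import Data.Integer.Properties as ℤ
open import Data.List.Base using (_∷_; [])
open import Data.List.Membership.Propositional using (_∈_)
open import Data.List.Relation.Unary.All as All using (All; []; _∷_)
open import Data.List.Relation.Unary.Any using (here; there)
open import Data.Maybe.Base as Maybe using (Maybe)
open import Data.Nat.Base as ℕ using (ℕ; zero; suc; s≤s; z≤n)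
import Data.Nat.Properties as ℕ
open import Data.Product.Base using (_×_; _,_; ∃; ∃-syntax; proj₁; proj₂)
import Data.Sign.Base as Sign
open import Data.Sum.Base using (_⊎_; inj₁; inj₂; [_,_]′)
open import Data.Vec.Base using (Vec; []; _∷_; lookup)
open import Function.Base using (_∘_; id)
open import Function.Bundles using (_⇔_; mk⇔; Equivalence)
open import Function.Construct.Symmetry using (⇔-sym)
open import Relation.Binary.Consequences using (dec⇒weaklyDec)
import Relation.Binary.Construct.Closure.ReflexiveTransitive as Star
open import Relation.Binary.Definitions using (tri<; tri≈; tri>)
open import Relation.Binary.PropositionalEquality as ≡ using (_≡_; _≢_)
open import Relation.Binary.Structures using (IsStrictTotalOrder)
open import Relation.Nullary.Decidable
  using (Dec; yes; no; does; _×-dec_; does-⇔; dec-true; dec-false)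
open import Relation.Nullary.Negation.Core using (¬_; contradiction)

open Equivalence using (to; from)

-- A ring solver with integer coefficients.

module IntegerSolver {c ℓ₁ ℓ₂} (K : OrderedField c ℓ₁ ℓ₂) where
  open OrderedField K hiding (zero)
  open import Algebra.Properties.Ring ring
  open import Algebra.Properties.Semiring.Mult.TCOptimised semiring
    renaming (_×_ to _·_)
  open import Relation.Binary.Reasoning.Setoid setoid

  -- Equality in the field does not compute, so the solver takes its coefficients from ℤ, where
  -- cancellation can be decided. The multiple `_·_` is the variant for which the images of 0 and 1
  -- reduce to `0#` and `1#`, so that `con 0ℤ` and `con 1ℤ` denote these constants by computation.
  fromℤ : ℤ → Carrier
  fromℤ (+ n)    = n · 1#
  fromℤ -[1+ n ] = - (suc n · 1#)

  fromℤ-neg : ∀ i → fromℤ (ℤ.- i) ≈ - fromℤ i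
  fromℤ-neg (+ zero)   = sym -0#≈0#
  fromℤ-neg (+ suc n)  = refl
  fromℤ-neg (-[1+ n ]) = sym (-‿involutive _)

  fromℤ-⊖ : ∀ m n → fromℤ (m ℤ.⊖ n) ≈ m · 1# - n · 1#
  fromℤ-⊖ m       zero    = sym (trans (+-congˡ -0#≈0#) (+-identityʳ _))
  fromℤ-⊖ zero    (suc n) = sym (+-identityˡ _)
  fromℤ-⊖ (suc m) (suc n) = begin
    fromℤ (suc m ℤ.⊖ suc n)                 ≡⟨ ≡.cong fromℤ (ℤ.[1+m]⊖[1+n]≡m⊖n m n) ⟩
    fromℤ (m ℤ.⊖ n)                         ≈⟨ fromℤ-⊖ m n ⟩
    m · 1# - n · 1#                         ≈⟨ +-congʳ (+-identityʳ _) ⟨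
    m · 1# + 0# - n · 1#                    ≈⟨ +-congʳ (+-congˡ (-‿inverseʳ 1#)) ⟨
    m · 1# + (1# - 1#) - n · 1#             ≈⟨ +-congʳ (+-assoc _ _ _) ⟨
    m · 1# + 1# - 1# - n · 1#               ≈⟨ +-assoc _ _ _ ⟩
    m · 1# + 1# + (- 1# - n · 1#)           ≈⟨ +-cong (+-comm _ _) (-‿+-comm _ _) ⟩
    1# + m · 1# - (1# + n · 1#)             ≈⟨ +-cong (×-homo-+ 1# 1 m) (-‿cong (×-homo-+ 1# 1 n)) ⟨
    suc m · 1# - suc n · 1#                 ∎

  fromℤ-+ : ∀ i j → fromℤ (i ℤ.+ j) ≈ fromℤ i + fromℤ j
  fromℤ-+ (+ m)    (+ n)    = ×-homo-+ 1# m n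
  fromℤ-+ (+ m)    -[1+ n ] = fromℤ-⊖ m (suc n)
  fromℤ-+ -[1+ m ] (+ n)    = trans (fromℤ-⊖ n (suc m)) (+-comm _ _)
  fromℤ-+ -[1+ m ] -[1+ n ] = begin
    - (suc (suc (m ℕ.+ n)) · 1#)     ≡⟨ ≡.cong (λ k → - (suc k · 1#)) (≡.sym (ℕ.+-suc m n)) ⟩
    - ((suc m ℕ.+ suc n) · 1#)       ≈⟨ -‿cong (×-homo-+ 1# (suc m) (suc n)) ⟩
    - (suc m · 1# + suc n · 1#)      ≈⟨ -‿+-comm _ _ ⟨
    - (suc m · 1#) - suc n · 1#      ∎

  fromℤ-neg◃ : ∀ n → fromℤ (Sign.- ℤ.◃ n) ≈ - (n · 1#)
  fromℤ-neg◃ zero    = sym -0#≈0#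
  fromℤ-neg◃ (suc n) = refl

  fromℤ-pos◃ : ∀ n → fromℤ (Sign.+ ℤ.◃ n) ≈ n · 1#
  fromℤ-pos◃ zero    = refl
  fromℤ-pos◃ (suc n) = refl

  fromℤ-* : ∀ i j → fromℤ (i ℤ.* j) ≈ fromℤ i * fromℤ j
  fromℤ-* (+ m)    (+ n)    = trans (fromℤ-pos◃ (m ℕ.* n)) (×1-homo-* m n)
  fromℤ-* (+ m)    -[1+ n ] = trans (fromℤ-neg◃ (m ℕ.* suc n))
    (trans (-‿cong (×1-homo-* m (suc n))) (-‿distribʳ-* _ _))
  fromℤ-* -[1+ m ] (+ n)    = trans (fromℤ-neg◃ (suc m ℕ.* n))
    (trans (-‿cong (×1-homo-* (suc m) n)) (-‿distribˡ-* _ _))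
  fromℤ-* -[1+ m ] -[1+ n ] = begin
    (suc m ℕ.* suc n) · 1#             ≈⟨ ×1-homo-* (suc m) (suc n) ⟩
    suc m · 1# * suc n · 1#            ≈⟨ -‿involutive _ ⟨
    - - (suc m · 1# * suc n · 1#)      ≈⟨ -‿cong (-‿distribˡ-* _ _) ⟩
    - (- (suc m · 1#) * suc n · 1#)    ≈⟨ -‿distribʳ-* _ _ ⟩
    - (suc m · 1#) * - (suc n · 1#)    ∎

  ℤ-rawRing : RawRing _ _
  ℤ-rawRing = ℤ.+-*-rawRing

  fromℤ-morphism : ℤ-rawRing -Raw-AlmostCommutative⟶ fromCommutativeRing commutativeRing
  fromℤ-morphism = record
    { ⟦_⟧    = fromℤ
    ; +-homo = fromℤ-+
    ; *-homo = fromℤ-*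
    ; -‿homo = fromℤ-neg
    ; 0-homo = refl
    ; 1-homo = refl
    }

  fromℤ-≟ : ∀ i j → Maybe (fromℤ i ≈ fromℤ j)
  fromℤ-≟ i j = Maybe.map (λ { ≡.refl → refl }) (dec⇒weaklyDec ℤ._≟_ i j)

  open import Algebra.Solver.Ring ℤ-rawRing (fromCommutativeRing commutativeRing)
    fromℤ-morphism fromℤ-≟ public
    using (Polynomial; con; solve; _:+_; _:*_; _:-_; :-_; _:=_)

-- Signs and inequalities in an ordered field.

module OrderedFieldProperties {c ℓ₁ ℓ₂} (K : OrderedField c ℓ₁ ℓ₂) where
  open OrderedField K
  open IsStrictTotalOrder isStrictTotalOrder
    using (compare; irrefl; asym; <-respʳ-≈; <-respˡ-≈)
    renaming (trans to ≺-trans)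
  open IntegerSolver K

  Positive NonNegative Negative : Carrier → Set _
  Positive a    = 0# ≺ a
  NonNegative a = 0# ≼ a
  Negative a    = a ≺ 0#

  ≺⇒0≺- : ∀ {a b} → a ≺ b → Positive (b - a)
  ≺⇒0≺- {a} a≺b = <-respˡ-≈ (-‿inverseʳ a) (+-monoˡ-≺ (- a) a≺b)

  0≺-⇒≺ : ∀ {a b} → Positive (b - a) → a ≺ b
  0≺-⇒≺ {a} {b} 0≺b-a = <-respˡ-≈ (+-identityˡ a)
    (<-respʳ-≈ (solve 2 (λ a b → (b :- a) :+ a := b) refl a b) (+-monoˡ-≺ a 0≺b-a))

  positive-resp : ∀ {a b} → a ≈ b → Positive a → Positive b
  positive-resp = <-respʳ-≈

  nonNegative-resp : ∀ {a b} → a ≈ b → NonNegative a → NonNegative b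
  nonNegative-resp a≈b (inj₁ 0≺a) = inj₁ (positive-resp a≈b 0≺a)
  nonNegative-resp a≈b (inj₂ 0≈a) = inj₂ (trans 0≈a a≈b)

  negative⇒positive : ∀ {a} → Negative a → Positive (- a)
  negative⇒positive {a} a≺0 = positive-resp (+-identityˡ (- a)) (≺⇒0≺- a≺0)

  positive⇒negative : ∀ {a} → Positive (- a) → Negative a
  positive⇒negative {a} 0≺-a = 0≺-⇒≺ (positive-resp (sym (+-identityˡ (- a))) 0≺-a)

  positive-≉0 : ∀ {a} → Positive a → ¬ (a ≈ 0#)
  positive-≉0 0≺a a≈0 = irrefl (sym a≈0) 0≺a

  positive-asym : ∀ {a} → Positive a → ¬ Positive (- a)
  positive-asym 0≺a 0≺-a = asym 0≺a (positive⇒negative 0≺-a)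

  nonNegative-positive : ∀ {a} → NonNegative a → ¬ Positive (- a)
  nonNegative-positive (inj₁ 0≺a) 0≺-a = positive-asym 0≺a 0≺-a
  nonNegative-positive (inj₂ 0≈a) 0≺-a = irrefl (sym 0≈a) (positive⇒negative 0≺-a)

  sign : ∀ a → Positive (- a) ⊎ NonNegative a
  sign a with compare 0# a
  ... | tri< 0≺a _ _ = inj₂ (inj₁ 0≺a)
  ... | tri≈ _ 0≈a _ = inj₂ (inj₂ 0≈a)
  ... | tri> _ _ a≺0 = inj₁ (negative⇒positive a≺0)

  positive+positive : ∀ {a b} → Positive a → Positive b → Positive (a + b)
  positive+positive {a} {b} 0≺a 0≺b =
    ≺-trans 0≺b (<-respˡ-≈ (+-identityˡ b) (+-monoˡ-≺ b 0≺a))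

  positive+nonNegative : ∀ {a b} → Positive a → NonNegative b → Positive (a + b)
  positive+nonNegative 0≺a (inj₁ 0≺b) = positive+positive 0≺a 0≺b
  positive+nonNegative {a} 0≺a (inj₂ 0≈b) =
    positive-resp (trans (sym (+-identityʳ a)) (+-congˡ 0≈b)) 0≺a

  nonNegative+positive : ∀ {a b} → NonNegative a → Positive b → Positive (a + b)
  nonNegative+positive 0≼a 0≺b = positive-resp (+-comm _ _) (positive+nonNegative 0≺b 0≼a)

  nonNegative+nonNegative : ∀ {a b} → NonNegative a → NonNegative b → NonNegative (a + b)
  nonNegative+nonNegative (inj₁ 0≺a) 0≼b = inj₁ (positive+nonNegative 0≺a 0≼b)
  nonNegative+nonNegative {b = b} (inj₂ 0≈a) 0≼b =
    nonNegative-resp (trans (sym (+-identityˡ b)) (+-congʳ 0≈a)) 0≼b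

  nonNegative*nonNegative : ∀ {a b} → NonNegative a → NonNegative b → NonNegative (a * b)
  nonNegative*nonNegative (inj₁ 0≺a) (inj₁ 0≺b) = inj₁ (*-positive 0≺a 0≺b)
  nonNegative*nonNegative {b = b} (inj₂ 0≈a) _  = inj₂ (trans (sym (zeroˡ b)) (*-congʳ 0≈a))
  nonNegative*nonNegative {a} (inj₁ _) (inj₂ 0≈b) =
    inj₂ (trans (sym (zeroʳ a)) (*-congˡ 0≈b))

  square-positive : ∀ {a} → ¬ (a ≈ 0#) → Positive (a * a)
  square-positive {a} a≉0 with compare 0# a
  ... | tri< 0≺a _ _ = *-positive 0≺a 0≺a
  ... | tri≈ _ 0≈a _ = contradiction (sym 0≈a) a≉0
  ... | tri> _ _ a≺0 = positive-resp (solve 1 (λ a → :- a :* :- a := a :* a) refl a)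
                         (*-positive (negative⇒positive a≺0) (negative⇒positive a≺0))

  square-nonNegative : ∀ a → NonNegative (a * a)
  square-nonNegative a with compare 0# a
  ... | tri< 0≺a _ _ = inj₁ (*-positive 0≺a 0≺a)
  ... | tri≈ _ 0≈a _ = inj₂ (trans (sym (zeroˡ a)) (*-congʳ 0≈a))
  ... | tri> _ _ a≺0 = inj₁ (square-positive (λ a≈0 → irrefl a≈0 a≺0))

  sumOfSquares-positive : ∀ {a b} → ¬ (a ≈ 0# × b ≈ 0#) → Positive (a * a + b * b)
  sumOfSquares-positive {a} {b} nonzero with compare 0# a
  ... | tri< 0≺a _ _ = positive+nonNegative (*-positive 0≺a 0≺a) (square-nonNegative b)
  ... | tri≈ _ 0≈a _ = nonNegative+positive (square-nonNegative a)
                         (square-positive (λ b≈0 → nonzero (sym 0≈a , b≈0)))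
  ... | tri> _ _ a≺0 = positive+nonNegative (square-positive (λ a≈0 → irrefl a≈0 a≺0))
                         (square-nonNegative b)

  positive-cancelˡ-* : ∀ {a b} → NonNegative a → Positive (a * b) → Positive b
  positive-cancelˡ-* {a} {b} 0≼a 0≺ab with sign (- b)
  ... | inj₁ 0≺--b = positive-resp (solve 1 (λ b → :- (:- b) := b) refl b) 0≺--b
  ... | inj₂ 0≼-b  = contradiction
    (positive-resp (solve 2 (λ a b → a :* b := :- (a :* :- b)) refl a b) 0≺ab)
    (nonNegative-positive (nonNegative*nonNegative 0≼a 0≼-b))

  nonNegative-cancelˡ-* : ∀ {a b} → Positive a → NonNegative (a * b) → NonNegative b
  nonNegative-cancelˡ-* {a} {b} 0≺a 0≼ab with sign b
  ... | inj₂ 0≼b  = 0≼b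
  ... | inj₁ 0≺-b = contradiction
    (positive-resp (solve 2 (λ a b → a :* :- b := :- (a :* b)) refl a b) (*-positive 0≺a 0≺-b))
    (nonNegative-positive 0≼ab)

  positive-inverse : ∀ {a} → Positive a → ∃[ b ] Positive b × a * b ≈ 1#
  positive-inverse 0≺a with inverse (positive-≉0 0≺a)
  ... | b , ab≈1 = b , positive-cancelˡ-* (inj₁ 0≺a) (positive-resp (sym ab≈1) 0≺1) , ab≈1

  ≼⇒nonNegative : ∀ {a b} → a ≼ b → NonNegative (b - a)
  ≼⇒nonNegative (inj₁ a≺b) = inj₁ (≺⇒0≺- a≺b)
  ≼⇒nonNegative {a} (inj₂ a≈b) = inj₂ (trans (sym (-‿inverseʳ a)) (+-congʳ a≈b))

  nonNegative⇒≼ : ∀ {a b} → NonNegative (b - a) → a ≼ b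
  nonNegative⇒≼ (inj₁ 0≺b-a) = inj₁ (0≺-⇒≺ 0≺b-a)
  nonNegative⇒≼ {a} {b} (inj₂ 0≈b-a) = inj₂ (trans (sym (+-identityˡ a))
    (trans (+-congʳ 0≈b-a) (solve 2 (λ a b → (b :- a) :+ a := b) refl a b)))

-- Orientation, circle, disk and segments.

module PlaneProperties {c ℓ₁ ℓ₂} (K : OrderedField c ℓ₁ ℓ₂) where
  open OrderedField K
  open Plane K
  open IntegerSolver K
  open OrderedFieldProperties K

  private
    Pt : _ → Set
    Pt n = Polynomial n × Polynomial n

    :orient : ∀ {n} → Pt n → Pt n → Pt n → Polynomial n
    :orient (p₁ , p₂) (q₁ , q₂) (r₁ , r₂) =
      (q₁ :- p₁) :* (r₂ :- p₂) :- (q₂ :- p₂) :* (r₁ :- p₁)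

    :∥_∥² : ∀ {n} → Pt n → Polynomial n
    :∥ a , b ∥² = a :* a :+ b :* b

    :dist² : ∀ {n} → Pt n → Pt n → Polynomial n
    :dist² (p₁ , p₂) (q₁ , q₂) = (q₁ :- p₁) :* (q₁ :- p₁) :+ (q₂ :- p₂) :* (q₂ :- p₂)

    :along : ∀ {n} → Pt n → Pt n → Polynomial n → Pt n
    :along (p₁ , p₂) (q₁ , q₂) t =
      (con 1ℤ :- t) :* p₁ :+ t :* q₁ , (con 1ℤ :- t) :* p₂ :+ t :* q₂

  dist² : Point → Point → Carrier
  dist² (p₁ , p₂) (q₁ , q₂) = (q₁ - p₁) * (q₁ - p₁) + (q₂ - p₂) * (q₂ - p₂)

  x-y≈0⇒x≈y : ∀ {x y} → x - y ≈ 0# → x ≈ y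
  x-y≈0⇒x≈y {x} {y} x-y≈0 =
    trans (solve 2 (λ x y → x := (x :- y) :+ y) refl x y) (trans (+-congʳ x-y≈0) (+-identityˡ y))

  x≈y⇒x-y≈0 : ∀ {x y} → x ≈ y → x - y ≈ 0#
  x≈y⇒x-y≈0 {x} {y} x≈y = trans (+-congʳ x≈y) (-‿inverseʳ y)

  ≋-sym : ∀ {p q} → p ≋ q → q ≋ p
  ≋-sym (p₁≈q₁ , p₂≈q₂) = sym p₁≈q₁ , sym p₂≈q₂

  orient-rotate : ∀ p q r → orient p q r ≈ orient q r p
  orient-rotate (p₁ , p₂) (q₁ , q₂) (r₁ , r₂) =
    solve 6 (λ p₁ p₂ q₁ q₂ r₁ r₂ →
      :orient (p₁ , p₂) (q₁ , q₂) (r₁ , r₂) := :orient (q₁ , q₂) (r₁ , r₂) (p₁ , p₂))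
      refl p₁ p₂ q₁ q₂ r₁ r₂

  orient-swap : ∀ p q r → orient q p r ≈ - orient p q r
  orient-swap (p₁ , p₂) (q₁ , q₂) (r₁ , r₂) =
    solve 6 (λ p₁ p₂ q₁ q₂ r₁ r₂ →
      :orient (q₁ , q₂) (p₁ , p₂) (r₁ , r₂) := :- :orient (p₁ , p₂) (q₁ , q₂) (r₁ , r₂))
      refl p₁ p₂ q₁ q₂ r₁ r₂

  orient-swapʳ : ∀ p q r → orient p r q ≈ - orient p q r
  orient-swapʳ p q r = trans (orient-rotate p r q)
    (trans (orient-rotate r q p) (orient-swap p q r))

  orient-start : ∀ p q → orient p q p ≈ 0#
  orient-start (p₁ , p₂) (q₁ , q₂) =
    solve 4 (λ p₁ p₂ q₁ q₂ → :orient (p₁ , p₂) (q₁ , q₂) (p₁ , p₂) := con 0ℤ) refl p₁ p₂ q₁ q₂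

  orient-end : ∀ p q → orient p q q ≈ 0#
  orient-end (p₁ , p₂) (q₁ , q₂) =
    solve 4 (λ p₁ p₂ q₁ q₂ → :orient (p₁ , p₂) (q₁ , q₂) (q₁ , q₂) := con 0ℤ) refl p₁ p₂ q₁ q₂

  orient-cong : ∀ p q {r s} → r ≋ s → orient p q r ≈ orient p q s
  orient-cong p q (r₁≈s₁ , r₂≈s₂) =
    +-cong (*-congˡ (+-congʳ r₂≈s₂)) (-‿cong (*-congˡ (+-congʳ r₁≈s₁)))

  orient-along : ∀ p q z w t →
    orient p q (along z w t) ≈ (1# - t) * orient p q z + t * orient p q w
  orient-along (p₁ , p₂) (q₁ , q₂) (z₁ , z₂) (w₁ , w₂) t =
    solve 9 (λ p₁ p₂ q₁ q₂ z₁ z₂ w₁ w₂ t →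
      let p = p₁ , p₂ ; q = q₁ , q₂ ; z = z₁ , z₂ ; w = w₁ , w₂ in
      :orient p q (:along z w t) :=
      (con 1ℤ :- t) :* :orient p q z :+ t :* :orient p q w)
      refl p₁ p₂ q₁ q₂ z₁ z₂ w₁ w₂ t

  dist²-nonNegative : ∀ p q → NonNegative (dist² p q)
  dist²-nonNegative _ _ =
    nonNegative+nonNegative (square-nonNegative _) (square-nonNegative _)

  dist²-positive : ∀ {p q} → ¬ (p ≋ q) → Positive (dist² p q)
  dist²-positive p≢q = sumOfSquares-positive λ (d₁≈0 , d₂≈0) →
    p≢q (sym (x-y≈0⇒x≈y d₁≈0) , sym (x-y≈0⇒x≈y d₂≈0))

  clockwise⇒≢ : ∀ {p q r} → Clockwise p q r → ¬ (p ≋ q)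
  clockwise⇒≢ {p₁ , p₂} {q₁ , q₂} {r₁ , r₂} pqr (p₁≈q₁ , p₂≈q₂) =
    positive-≉0 (negative⇒positive pqr) (trans (-‿cong
      (+-cong (*-congʳ (x≈y⇒x-y≈0 (sym p₁≈q₁))) (-‿cong (*-congʳ (x≈y⇒x-y≈0 (sym p₂≈q₂))))))
      (solve 2 (λ a b → :- (con 0ℤ :* a :- con 0ℤ :* b) := con 0ℤ) refl (r₂ - p₂) (r₁ - p₁)))

  clockwise-rotate : ∀ {p q r} → Clockwise p q r → Clockwise q r p
  clockwise-rotate {p} {q} {r} pqr = positive⇒negative
    (positive-resp (-‿cong (orient-rotate p q r)) (negative⇒positive pqr))

  -- Serves to prove identities modulo vanishing quantities such as |p|² - 1: the solver gets the
  -- identity with explicit multiples of these quantities added, and each use of this lemma discards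
  -- the last multiple.
  drop-zero : ∀ {x y a n} → x ≈ y + a * n → n ≈ 0# → x ≈ y
  drop-zero {y = y} {a} x≈y+an n≈0 =
    trans x≈y+an (trans (+-congˡ (trans (*-congˡ n≈0) (zeroʳ a))) (+-identityʳ y))

  onCircle⇒≈0 : ∀ {p} → OnCircle p → ∥ p ∥² - 1# ≈ 0#
  onCircle⇒≈0 = x≈y⇒x-y≈0

  -- Cofactor expansion of the in-circle determinant of p, q, r, s.
  orient-dist² : ∀ p q r s → OnCircle p → OnCircle q → OnCircle r → OnCircle s →
    orient p q s * dist² p r ≈ orient p r s * dist² p q + orient p q r * dist² p s
  orient-dist² p@(p₁ , p₂) q@(q₁ , q₂) r@(r₁ , r₂) s@(s₁ , s₂) p∈ q∈ r∈ s∈ =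
    drop-zero (drop-zero (drop-zero (drop-zero
      (solve 8 (λ p₁ p₂ q₁ q₂ r₁ r₂ s₁ s₂ →
        let p = p₁ , p₂ ; q = q₁ , q₂ ; r = r₁ , r₂ ; s = s₁ , s₂ in
        :orient p q s :* :dist² p r :=
        :orient p r s :* :dist² p q :+ :orient p q r :* :dist² p s
          :+ :orient q r s :* (:∥ p ∥² :- con 1ℤ)
          :+ :orient p q s :* (:∥ r ∥² :- con 1ℤ)
          :+ (:- :orient p r s) :* (:∥ q ∥² :- con 1ℤ)
          :+ (:- :orient p q r) :* (:∥ s ∥² :- con 1ℤ))
        refl p₁ p₂ q₁ q₂ r₁ r₂ s₁ s₂)
      (onCircle⇒≈0 {s} s∈)) (onCircle⇒≈0 {q} q∈)) (onCircle⇒≈0 {r} r∈)) (onCircle⇒≈0 {p} p∈)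

  -- By `orient-dist²`, `orient p q s` times `dist² p r` is a combination of the two given
  -- orientations with nonnegative weights. The weight `dist² p q` is positive because a clockwise
  -- turn has p distinct from q.
  clockwise-trans : ∀ {p q r s} → OnCircle p → OnCircle q → OnCircle r → OnCircle s →
    Clockwise p q r → Clockwise p r s → Clockwise p q s
  clockwise-trans {p} {q} {r} {s} p∈ q∈ r∈ s∈ pqr prs = positive⇒negative
    (positive-cancelˡ-* (dist²-nonNegative p r)
      (positive-resp eq
        (positive+nonNegative
          (*-positive (negative⇒positive prs) (dist²-positive (clockwise⇒≢ {p} {q} {r} pqr)))
          (nonNegative*nonNegative (inj₁ (negative⇒positive pqr)) (dist²-nonNegative p s)))))
    where
    eq : - orient p r s * dist² p q + - orient p q r * dist² p s ≈ dist² p r * - orient p q s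
    eq = trans
      (solve 4 (λ a b c d → :- a :* b :+ :- c :* d := :- (a :* b :+ c :* d)) refl _ _ _ _)
      (trans (-‿cong (sym (orient-dist² p q r s p∈ q∈ r∈ s∈)))
        (solve 2 (λ a b → :- (a :* b) := b :* :- a) refl _ _))

  -- The second intersection of the circle with a line through p; the
  -- direction is chosen such that this point is on the clockwise arc from p to q.
  arc-inhabited : ∀ p q → OnCircle p → OnCircle q → ¬ (p ≋ q) → ∃[ a ] Arc p q a
  arc-inhabited p@(p₁ , p₂) q@(q₁ , q₂) p∈ q∈ p≢q =
    a , a∈ , (λ a≋p → clockwise⇒≢ {p} {a} {q} paq (≋-sym a≋p)) ,
    clockwise⇒≢ {a} {q} {p} (clockwise-rotate {p} {a} {q} paq) , λ _ → paq
    where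
    E = dist² p q
    e₁ = q₁ - p₁
    e₂ = q₂ - p₂
    D = p₁ * e₂ - p₂ * e₁
    -- The line has direction d = E (-e₂, e₁) + β (e₁, e₂), and |p + r d|² = 1 has the nonzero
    -- solution r = L / M. The choice of `β` makes L = 1 + (1 + D)², so that r is positive for every
    -- D.
    β = 1# + 1# + D * D
    L = D + D + β
    M = E * E + β * β

    E-pos : Positive E
    E-pos = dist²-positive p≢q

    L-pos : Positive L
    L-pos = positive-resp
      (solve 1 (λ D → con 1ℤ :+ (con 1ℤ :+ D) :* (con 1ℤ :+ D)
                   := D :+ D :+ (con 1ℤ :+ con 1ℤ :+ D :* D)) refl D)
      (positive+nonNegative 0≺1 (square-nonNegative (1# + D)))

    M⁻¹ : ∃[ J ] Positive J × M * J ≈ 1#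
    M⁻¹ = positive-inverse
      (positive+nonNegative (*-positive E-pos E-pos) (square-nonNegative β))

    J = proj₁ M⁻¹
    r = L * J

    r-pos : Positive r
    r-pos = *-positive L-pos (proj₁ (proj₂ M⁻¹))

    a : Point
    a = p₁ + r * (E * - e₂ + β * e₁) , p₂ + r * (E * e₁ + β * e₂)

    -- The coefficients are free variables here, which keeps the degree of the polynomials low; `E`,
    -- `β` and `r` are substituted afterwards.
    norm : ∀ k β r →
      ∥ p₁ + r * (k * - e₂ + β * e₁) , p₂ + r * (k * e₁ + β * e₂) ∥² ≈
      1# + (r * ((k * k + β * β) * r * E - k * (D + D) - β * E))
        + (1# - r * β) * (∥ p ∥² - 1#) + r * β * (∥ q ∥² - 1#)
    norm k β r = solve 7 (λ p₁ p₂ q₁ q₂ k β r →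
      let e₁ = q₁ :- p₁ ; e₂ = q₂ :- p₂ ; D = p₁ :* e₂ :- p₂ :* e₁
          E = :dist² (p₁ , p₂) (q₁ , q₂) in
      :∥ p₁ :+ r :* (k :* :- e₂ :+ β :* e₁) , p₂ :+ r :* (k :* e₁ :+ β :* e₂) ∥² :=
      con 1ℤ :+ r :* ((k :* k :+ β :* β) :* r :* E :- k :* (D :+ D) :- β :* E)
        :+ (con 1ℤ :- r :* β) :* (:∥ p₁ , p₂ ∥² :- con 1ℤ)
        :+ r :* β :* (:∥ q₁ , q₂ ∥² :- con 1ℤ))
      refl p₁ p₂ q₁ q₂ k β r

    factor : r * (M * r * E - E * (D + D) - β * E) ≈ 0# + r * E * L * (M * J - 1#)
    factor = solve 5 (λ M J E D β →
      let L = D :+ D :+ β ; r = L :* J in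
      r :* (M :* r :* E :- E :* (D :+ D) :- β :* E) :=
      con 0ℤ :+ r :* E :* L :* (M :* J :- con 1ℤ)) refl M J E D β

    a∈ : OnCircle a
    a∈ = trans (drop-zero (drop-zero (norm E β r) (onCircle⇒≈0 {q} q∈)) (onCircle⇒≈0 {p} p∈))
      (trans (+-congˡ (drop-zero factor (x≈y⇒x-y≈0 (proj₂ (proj₂ M⁻¹))))) (+-identityʳ 1#))

    paq-eq : ∀ k β r →
      r * (k * E) ≈ - orient p (p₁ + r * (k * - e₂ + β * e₁) , p₂ + r * (k * e₁ + β * e₂)) q
    paq-eq k β r = solve 7 (λ p₁ p₂ q₁ q₂ k β r →
      let e₁ = q₁ :- p₁ ; e₂ = q₂ :- p₂ in
      r :* (k :* :dist² (p₁ , p₂) (q₁ , q₂)) :=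
      :- :orient (p₁ , p₂)
        (p₁ :+ r :* (k :* :- e₂ :+ β :* e₁) , p₂ :+ r :* (k :* e₁ :+ β :* e₂)) (q₁ , q₂))
      refl p₁ p₂ q₁ q₂ k β r

    paq : Clockwise p a q
    paq = positive⇒negative
      (positive-resp (paq-eq E β r) (*-positive r-pos (*-positive E-pos E-pos)))

  inDisk-resp : ∀ {z w} → z ≋ w → InDisk z → InDisk w
  inDisk-resp (z₁≈w₁ , z₂≈w₂) z∈ = nonNegative⇒≼ (nonNegative-resp
    (+-congˡ (-‿cong (+-cong (*-cong z₁≈w₁ z₁≈w₁) (*-cong z₂≈w₂ z₂≈w₂)))) (≼⇒nonNegative z∈))

  -- Stewart's identity: 1 - |z|² is concave along a segment, with defect t (1 - t) `dist² z w`.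
  1-∥along∥² : ∀ z w t → 1# - ∥ along z w t ∥² ≈
    (1# - t) * (1# - ∥ z ∥²) + t * (1# - ∥ w ∥²) + t * (1# - t) * dist² z w
  1-∥along∥² (z₁ , z₂) (w₁ , w₂) t = solve 5 (λ z₁ z₂ w₁ w₂ t →
    let z = z₁ , z₂ ; w = w₁ , w₂ in
    con 1ℤ :- :∥ :along z w t ∥² :=
    (con 1ℤ :- t) :* (con 1ℤ :- :∥ z ∥²) :+ t :* (con 1ℤ :- :∥ w ∥²)
      :+ t :* (con 1ℤ :- t) :* :dist² z w) refl z₁ z₂ w₁ w₂ t

  inDisk-convex : ∀ {z w v} → InDisk z → InDisk w → Segment z w v → InDisk v
  inDisk-convex {z} {w} {v} z∈ w∈ (t , 0≼t , t≼1 , v≋) =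
    inDisk-resp {along z w t} {v} (≋-sym v≋) (nonNegative⇒≼ (nonNegative-resp (sym (1-∥along∥² z w t))
      (nonNegative+nonNegative
        (nonNegative+nonNegative
          (nonNegative*nonNegative 0≼1-t (≼⇒nonNegative z∈))
          (nonNegative*nonNegative 0≼t (≼⇒nonNegative w∈)))
        (nonNegative*nonNegative (nonNegative*nonNegative 0≼t 0≼1-t) (dist²-nonNegative z w)))))
    where
    0≼1-t = ≼⇒nonNegative t≼1

  along-zero : ∀ z w → z ≋ along z w 0#
  along-zero (z₁ , z₂) (w₁ , w₂) = coord z₁ w₁ , coord z₂ w₂
    where
    coord = solve 2 (λ a b → a := (con 1ℤ :- con 0ℤ) :* a :+ con 0ℤ :* b) refl

  along-one : ∀ z w → w ≋ along z w 1#
  along-one (z₁ , z₂) (w₁ , w₂) = coord z₁ w₁ , coord z₂ w₂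
    where
    coord = solve 2 (λ a b → b := (con 1ℤ :- con 1ℤ) :* a :+ con 1ℤ :* b) refl

  segment-start : ∀ z w → Segment z w z
  segment-start z w = 0# , inj₂ refl , inj₁ 0≺1 , along-zero z w

  segment-end : ∀ z w → Segment z w w
  segment-end z w = 1# , inj₁ 0≺1 , inj₂ refl , along-one z w

  orient-segment : ∀ p q {z w v} ((t , _) : Segment z w v) →
    orient p q v ≈ (1# - t) * orient p q z + t * orient p q w
  orient-segment p q {z} {w} (t , _ , _ , v≋) =
    trans (orient-cong p q v≋) (orient-along p q z w t)

  segment⇒orient≈0 : ∀ p q {z} → Segment p q z → orient p q z ≈ 0#
  segment⇒orient≈0 p q pqz@(t , _) = trans (orient-segment p q pqz)
    (trans (+-cong (*-congˡ (orient-start p q)) (*-congˡ (orient-end p q)))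
      (solve 1 (λ t → (con 1ℤ :- t) :* con 0ℤ :+ t :* con 0ℤ := con 0ℤ) refl t))

  -- If a were negative, then b = (a + b) - a would be positive and the product negative.
  nonNegative-factor : ∀ {a b} → NonNegative (a * b) → Positive (a + b) → NonNegative a
  nonNegative-factor {a} {b} 0≼ab 0≺a+b with sign a
  ... | inj₂ 0≼a  = 0≼a
  ... | inj₁ 0≺-a = contradiction
    (positive-resp (solve 2 (λ a b → :- a :* (a :+ b :+ :- a) := :- (a :* b)) refl a b)
      (*-positive 0≺-a (positive+positive 0≺a+b 0≺-a)))
    (nonNegative-positive 0≼ab)

  -- The parameter `t` comes from projecting z orthogonally onto the line. For z on the line, 1 -
  -- |z|² = t (1 - t) `dist² p q`, so membership in the disk forces t and 1 - t to be nonnegative.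
  orient≈0⇒segment : ∀ p q z → OnCircle p → OnCircle q → ¬ (p ≋ q) →
    InDisk z → orient p q z ≈ 0# → Segment p q z
  orient≈0⇒segment p@(p₁ , p₂) q@(q₁ , q₂) z@(z₁ , z₂) p∈ q∈ p≢q z∈ pqz≈0 =
    t , t-nonNegative , nonNegative⇒≼ 1-t-nonNegative , z≋
    where
    E = dist² p q
    E-pos : Positive E
    E-pos = dist²-positive p≢q

    E⁻¹ : ∃[ J ] Positive J × E * J ≈ 1#
    E⁻¹ = positive-inverse E-pos

    J = proj₁ E⁻¹
    EJ-1≈0 = x≈y⇒x-y≈0 (proj₂ (proj₂ E⁻¹))
    t = ((z₁ - p₁) * (q₁ - p₁) + (z₂ - p₂) * (q₂ - p₂)) * J

    z≋ : z ≋ along p q t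
    z≋ =
      drop-zero (drop-zero (solve 7 (λ p₁ p₂ q₁ q₂ z₁ z₂ J →
        let t = ((z₁ :- p₁) :* (q₁ :- p₁) :+ (z₂ :- p₂) :* (q₂ :- p₂)) :* J
            p = p₁ , p₂ ; q = q₁ , q₂ ; z = z₁ , z₂ in
        z₁ := (con 1ℤ :- t) :* p₁ :+ t :* q₁ :+ (:- (J :* (q₂ :- p₂))) :* :orient p q z
               :+ (p₁ :- z₁) :* (:dist² p q :* J :- con 1ℤ))
        refl p₁ p₂ q₁ q₂ z₁ z₂ J) EJ-1≈0) pqz≈0 ,
      drop-zero (drop-zero (solve 7 (λ p₁ p₂ q₁ q₂ z₁ z₂ J →
        let t = ((z₁ :- p₁) :* (q₁ :- p₁) :+ (z₂ :- p₂) :* (q₂ :- p₂)) :* J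
            p = p₁ , p₂ ; q = q₁ , q₂ ; z = z₁ , z₂ in
        z₂ := (con 1ℤ :- t) :* p₂ :+ t :* q₂ :+ J :* (q₁ :- p₁) :* :orient p q z
               :+ (p₂ :- z₂) :* (:dist² p q :* J :- con 1ℤ))
        refl p₁ p₂ q₁ q₂ z₁ z₂ J) EJ-1≈0) pqz≈0

    t[1-t]-nonNegative : NonNegative (t * (1# - t))
    t[1-t]-nonNegative = nonNegative-cancelˡ-* E-pos (nonNegative-resp
      (trans (1-∥along∥² p q t)
        (trans (+-congʳ (+-cong (*-congˡ (x≈y⇒x-y≈0 (sym p∈))) (*-congˡ (x≈y⇒x-y≈0 (sym q∈)))))
          (solve 2 (λ t E → (con 1ℤ :- t) :* con 0ℤ :+ t :* con 0ℤ :+ t :* (con 1ℤ :- t) :* E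
                         := E :* (t :* (con 1ℤ :- t))) refl t E)))
      (≼⇒nonNegative (inDisk-resp {z} {along p q t} z≋ z∈)))

    t-nonNegative : NonNegative t
    t-nonNegative = nonNegative-factor t[1-t]-nonNegative
      (positive-resp (solve 1 (λ t → con 1ℤ := t :+ (con 1ℤ :- t)) refl t) 0≺1)

    1-t-nonNegative : NonNegative (1# - t)
    1-t-nonNegative = nonNegative-factor (nonNegative-resp (*-comm t (1# - t)) t[1-t]-nonNegative)
      (positive-resp (solve 1 (λ t → con 1ℤ := (con 1ℤ :- t) :+ t) refl t) 0≺1)

  -- The zero of the affine function that is a at z and - b at w.
  crossing : ∀ p q z w → Positive (orient p q z) → NonNegative (- orient p q w) →
    ∃[ v ] Segment z w v × orient p q v ≈ 0#
  crossing p q z w 0≺a 0≼b = along z w t , (t , 0≼t , nonNegative⇒≼ 0≼1-t , refl , refl) ,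
    trans (orient-along p q z w t)
      (drop-zero (solve 3 (λ a w J →
          (con 1ℤ :- a :* J) :* a :+ a :* J :* w :=
          con 0ℤ :+ (:- a) :* ((a :- w) :* J :- con 1ℤ)) refl a (orient p q w) J)
        (x≈y⇒x-y≈0 (proj₂ (proj₂ s⁻¹))))
    where
    a = orient p q z
    b = - orient p q w

    s⁻¹ : ∃[ J ] Positive J × (a + b) * J ≈ 1#
    s⁻¹ = positive-inverse (positive+nonNegative 0≺a 0≼b)

    J = proj₁ s⁻¹
    0≺J = proj₁ (proj₂ s⁻¹)
    t = a * J

    0≼t : NonNegative t
    0≼t = inj₁ (*-positive 0≺a 0≺J)

    0≼1-t : NonNegative (1# - t)
    0≼1-t = nonNegative-resp
      (trans (solve 3 (λ a b J → b :* J := (a :+ b) :* J :- a :* J) refl a b J)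
        (+-congʳ (proj₂ (proj₂ s⁻¹))))
      (nonNegative*nonNegative 0≼b (inj₁ 0≺J))

  positive-convex : ∀ {a b t} → Positive a → Positive b → NonNegative t → t ≼ 1# →
    Positive ((1# - t) * a + t * b)
  positive-convex 0≺a 0≺b (inj₁ 0≺t) t≼1 = nonNegative+positive
    (nonNegative*nonNegative (≼⇒nonNegative t≼1) (inj₁ 0≺a)) (*-positive 0≺t 0≺b)
  positive-convex {a} {b} 0≺a _ (inj₂ 0≈t) _ = positive-resp
    (trans (solve 2 (λ a b → a := (con 1ℤ :- con 0ℤ) :* a :+ con 0ℤ :* b) refl a b)
      (+-cong (*-congʳ (+-congˡ (-‿cong 0≈t))) (*-congʳ 0≈t)))
    0≺a

  near-refl : ∀ ε z → Positive ε → Near ε z z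
  near-refl ε (z₁ , z₂) 0≺ε = coord z₁ , coord z₂
    where
    coord : ∀ x → x - ε ≺ x × x ≺ x + ε
    coord x =
      0≺-⇒≺ (positive-resp (solve 2 (λ x ε → ε := x :- (x :- ε)) refl x ε) 0≺ε) ,
      0≺-⇒≺ (positive-resp (solve 2 (λ x ε → ε := (x :+ ε) :- x) refl x ε) 0≺ε)

  -- Take t = 2ε / (2ε + 1 + |a - z|²). The distances ε ± tδ to the two bounds of a coordinate are
  -- then `ε * J` times 2ε + (1 ± δ)² + δ′², hence positive.
  near-along : ∀ ε z a → Positive ε →
    ∃[ t ] Positive t × t ≼ 1# × Near ε z (along z a t)
  near-along ε z@(z₁ , z₂) a@(a₁ , a₂) 0≺ε =
    t , *-positive 0≺2ε 0≺J , nonNegative⇒≼ 0≼1-t ,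
    (0≺-⇒≺ (lower z₁ a₁ δ₂ refl) , 0≺-⇒≺ (upper z₁ a₁ δ₂ refl)) ,
    (0≺-⇒≺ (lower z₂ a₂ δ₁ M-comm) , 0≺-⇒≺ (upper z₂ a₂ δ₁ M-comm))
    where
    δ₁ = a₁ - z₁
    δ₂ = a₂ - z₂
    L = 1# + (δ₁ * δ₁ + δ₂ * δ₂)
    M = ε + ε + L
    0≺2ε = positive+positive 0≺ε 0≺ε

    0≺L : Positive L
    0≺L = positive+nonNegative 0≺1 (nonNegative+nonNegative (square-nonNegative δ₁) (square-nonNegative δ₂))

    M⁻¹ : ∃[ J ] Positive J × M * J ≈ 1#
    M⁻¹ = positive-inverse (positive+positive 0≺2ε 0≺L)

    J = proj₁ M⁻¹
    0≺J = proj₁ (proj₂ M⁻¹)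
    MJ≈1 = proj₂ (proj₂ M⁻¹)
    t = (ε + ε) * J

    0≼1-t : NonNegative (1# - t)
    0≼1-t = inj₁ (positive-resp
      (trans (solve 3 (λ e L J → L :* J := (e :+ L) :* J :- e :* J) refl (ε + ε) L J) (+-congʳ MJ≈1))
      (*-positive 0≺L 0≺J))

    M-comm : M ≈ ε + ε + (1# + (δ₂ * δ₂ + δ₁ * δ₁))
    M-comm = +-congˡ (+-congˡ (+-comm _ _))

    M′J-1≈0 : ∀ {M′} → M ≈ M′ → M′ * J - 1# ≈ 0#
    M′J-1≈0 M≈M′ = x≈y⇒x-y≈0 (trans (*-congʳ (sym M≈M′)) MJ≈1)

    bound : ∀ δ δ′ → Positive (ε * J * (ε + ε + ((1# + δ) * (1# + δ) + δ′ * δ′)))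
    bound δ δ′ = *-positive (*-positive 0≺ε 0≺J) (positive+nonNegative 0≺2ε
      (nonNegative+nonNegative (square-nonNegative (1# + δ)) (square-nonNegative δ′)))

    lower : ∀ x y δ′ → let δ = y - x in M ≈ ε + ε + (1# + (δ * δ + δ′ * δ′)) →
      Positive ((1# - t) * x + t * y - (x - ε))
    lower x y δ′ M≈ = positive-resp
      (sym (drop-zero (solve 5 (λ x y δ′ ε J →
        let δ = y :- x ; t = (ε :+ ε) :* J ; one = con 1ℤ in
        (one :- t) :* x :+ t :* y :- (x :- ε) :=
        ε :* J :* (ε :+ ε :+ ((one :+ δ) :* (one :+ δ) :+ δ′ :* δ′))
          :+ (:- ε) :* ((ε :+ ε :+ (one :+ (δ :* δ :+ δ′ :* δ′))) :* J :- one))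
        refl x y δ′ ε J) (M′J-1≈0 M≈)))
      (bound (y - x) δ′)

    upper : ∀ x y δ′ → let δ = y - x in M ≈ ε + ε + (1# + (δ * δ + δ′ * δ′)) →
      Positive (x + ε - ((1# - t) * x + t * y))
    upper x y δ′ M≈ = positive-resp
      (sym (drop-zero (solve 5 (λ x y δ′ ε J →
        let δ = y :- x ; t = (ε :+ ε) :* J ; one = con 1ℤ in
        x :+ ε :- ((one :- t) :* x :+ t :* y) :=
        ε :* J :* (ε :+ ε :+ ((one :+ :- δ) :* (one :+ :- δ) :+ δ′ :* δ′))
          :+ (:- ε) :* ((ε :+ ε :+ (one :+ (δ :* δ :+ δ′ :* δ′))) :* J :- one))
        refl x y δ′ ε J) (M′J-1≈0 M≈)))
      (bound (- (y - x)) δ′)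

  -- A move by less than ε in each coordinate changes this affine function by at most ε (|e₁| +
  -- |e₂|), which is at most ε H. With ε = σ / (4 H) less than the value σ is lost.
  orient-positive-open : ∀ p q z → Positive (orient p q z) →
    ∃[ ε ] Positive ε × (∀ w → Near ε z w → Positive (orient p q w))
  orient-positive-open p@(p₁ , p₂) q@(q₁ , q₂) z@(z₁ , z₂) 0≺σ = ε , 0≺ε , near
    where
    σ = orient p q z
    e₁ = q₁ - p₁
    e₂ = q₂ - p₂
    H = 1# + (e₁ * e₁ + e₂ * e₂)
    4×_ : Carrier → Carrier
    4× x = x + x + (x + x)

    0≺H : Positive H
    0≺H = positive+nonNegative 0≺1 (nonNegative+nonNegative (square-nonNegative e₁) (square-nonNegative e₂))

    M⁻¹ : ∃[ J ] Positive J × 4× H * J ≈ 1#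
    M⁻¹ = positive-inverse (positive+positive (positive+positive 0≺H 0≺H) (positive+positive 0≺H 0≺H))

    J = proj₁ M⁻¹
    ε = σ * J

    0≺ε : Positive ε
    0≺ε = *-positive 0≺σ (proj₁ (proj₂ M⁻¹))

    0≼4 : NonNegative (4× 1#)
    0≼4 = inj₁ (positive+positive (positive+positive 0≺1 0≺1) (positive+positive 0≺1 0≺1))

    near : ∀ w → Near ε z w → Positive (orient p q w)
    near w@(w₁ , w₂) ((l₁ , u₁) , (l₂ , u₂)) =
      -- Absolute values are avoided by 4xy = x ((1 + y)² - (1 - y)²), which is where the factor 4
      -- comes from: each of the four bounds in `Near` is multiplied by a square.
      positive-cancelˡ-* 0≼4 (positive-resp (sym (drop-zero (solve 9 (λ p₁ p₂ q₁ q₂ z₁ z₂ w₁ w₂ J →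
          let one = con 1ℤ ; p = p₁ , p₂ ; q = q₁ , q₂ ; z = z₁ , z₂ ; w = w₁ , w₂
              e₁ = q₁ :- p₁ ; e₂ = q₂ :- p₂ ; σ = :orient p q z ; ε = σ :* J
              H = one :+ (e₁ :* e₁ :+ e₂ :* e₂) in
          (one :+ one :+ (one :+ one)) :* :orient p q w :=
          (σ :+ σ :+ σ :+ (ε :+ ε) :* (e₁ :* e₁ :+ e₂ :* e₂)
            :+ ((w₂ :- (z₂ :- ε)) :* ((one :+ e₁) :* (one :+ e₁))
            :+ ((z₂ :+ ε) :- w₂) :* ((one :- e₁) :* (one :- e₁))
            :+ (((z₁ :+ ε) :- w₁) :* ((one :+ e₂) :* (one :+ e₂))
            :+ (w₁ :- (z₁ :- ε)) :* ((one :- e₂) :* (one :- e₂)))))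
            :+ (:- σ) :* ((H :+ H :+ (H :+ H)) :* J :- one))
          refl p₁ p₂ q₁ q₂ z₁ z₂ w₁ w₂ J) (x≈y⇒x-y≈0 (proj₂ (proj₂ M⁻¹)))))
        (positive+nonNegative
          (positive+nonNegative (positive+positive (positive+positive 0≺σ 0≺σ) 0≺σ)
            (nonNegative*nonNegative (inj₁ (positive+positive 0≺ε 0≺ε))
              (nonNegative+nonNegative (square-nonNegative e₁) (square-nonNegative e₂))))
          (nonNegative+nonNegative
            (nonNegative+nonNegative (scaled l₂ (1# + e₁)) (scaled u₂ (1# - e₁)))
            (nonNegative+nonNegative (scaled u₁ (1# + e₂)) (scaled l₁ (1# - e₂))))))
      where
      scaled : ∀ {a b} → a ≺ b → ∀ x → NonNegative ((b - a) * (x * x))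
      scaled a≺b x = nonNegative*nonNegative (inj₁ (≺⇒0≺- a≺b)) (square-nonNegative x)

-- Cyclic order of the vertices and position of the arcs.

Cyclic : ∀ {n} → Fin n → Fin n → Fin n → Set
Cyclic i j k = (i Fin.< j × j Fin.< k) ⊎ (j Fin.< k × k Fin.< i) ⊎ (k Fin.< i × i Fin.< j)

cyclic-total : ∀ {n} {p q v : Fin n} → p ≢ q → v ≢ p → v ≢ q → Cyclic p v q ⊎ Cyclic q v p
cyclic-total {p = p} {q} {v} p≢q v≢p v≢q with <-cmp p q | <-cmp v p | <-cmp v q
... | tri≈ _ p≡q _ | _ | _ = contradiction p≡q p≢q
... | _ | tri≈ _ v≡p _ | _ = contradiction v≡p v≢p
... | _ | _ | tri≈ _ v≡q _ = contradiction v≡q v≢q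
... | tri< p<q _ _ | tri< v<p _ _ | tri< v<q _ _ = inj₂ (inj₂ (inj₁ (v<p , p<q)))
... | tri< p<q _ _ | tri< v<p _ _ | tri> _ _ q<v = inj₂ (inj₂ (inj₁ (v<p , p<q)))
... | tri< p<q _ _ | tri> _ _ p<v | tri< v<q _ _ = inj₁ (inj₁ (p<v , v<q))
... | tri< p<q _ _ | tri> _ _ p<v | tri> _ _ q<v = inj₂ (inj₂ (inj₂ (p<q , q<v)))
... | tri> _ _ q<p | tri< v<p _ _ | tri< v<q _ _ = inj₁ (inj₂ (inj₁ (v<q , q<p)))
... | tri> _ _ q<p | tri< v<p _ _ | tri> _ _ q<v = inj₂ (inj₁ (q<v , v<p))
... | tri> _ _ q<p | tri> _ _ p<v | tri< v<q _ _ = inj₁ (inj₂ (inj₁ (v<q , q<p)))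
... | tri> _ _ q<p | tri> _ _ p<v | tri> _ _ q<v = inj₁ (inj₂ (inj₂ (q<p , p<v)))

-- Arc u lies on the part of the circle that goes clockwise from p to q.
ArcWithin : ∀ {n} → Fin n → Fin n → Fin n → Set
ArcWithin u p q = (p Fin.< q × p Fin.< u × u Fin.≤ q) ⊎ (q Fin.< p × (u Fin.≤ q ⊎ p Fin.< u))

arcWithin-total : ∀ {n} (u : Fin n) {p q} → p ≢ q → ArcWithin u p q ⊎ ArcWithin u q p
arcWithin-total u {p} {q} p≢q with <-cmp p q | ℕ.<-≤-connex (toℕ p) (toℕ u) | ℕ.<-≤-connex (toℕ q) (toℕ u)
... | tri≈ _ p≡q _ | _        | _        = contradiction p≡q p≢q
... | tri< p<q _ _ | _        | inj₁ q<u = inj₂ (inj₂ (p<q , inj₂ q<u))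
... | tri< p<q _ _ | inj₁ p<u | inj₂ u≤q = inj₁ (inj₁ (p<q , p<u , u≤q))
... | tri< p<q _ _ | inj₂ u≤p | inj₂ _   = inj₂ (inj₂ (p<q , inj₁ u≤p))
... | tri> _ _ q<p | inj₁ p<u | _        = inj₁ (inj₂ (q<p , inj₂ p<u))
... | tri> _ _ q<p | inj₂ u≤p | inj₁ q<u = inj₂ (inj₁ (q<p , q<u , u≤p))
... | tri> _ _ q<p | inj₂ _   | inj₂ u≤q = inj₁ (inj₂ (q<p , inj₁ u≤q))

-- No chord f = {p, q} has arc u on one side and an end of e strictly on the
-- other.
Facing : ∀ {n l ℓ} → LabelledGraph n l ℓ → Fin l → Fin n → Set ℓ
Facing G e u = ∀ {f p q v w} → G f p q → G e v w → ArcWithin u p q → ¬ Cyclic q v p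

module _ {m : ℕ} where

  ≤⇒≡⊎< : ∀ {i j : Fin (suc m)} → i Fin.≤ j → i ≡ j ⊎ i Fin.< j
  ≤⇒≡⊎< {i} {j} i≤j with ℕ.m≤n⇒m<n∨m≡n i≤j
  ... | inj₁ i<j = inj₂ i<j
  ... | inj₂ i≡j = inj₁ (toℕ-injective i≡j)

  -- Translates inequalities into the cyclic order p, `prev u`, u, q, with coincidences allowed at
  -- both ends; in this form `clockwise-trans` can enlarge arc u to the arc from p to q. The arc of
  -- `zero` contains the jump from the last vertex to the first and is treated apart.
  arcWithin-bounds : ∀ (u : Fin (suc m)) {p q} → ArcWithin u p q →
    prev u ≢ u × (u ≡ q ⊎ Cyclic (prev u) u q) × (p ≡ prev u ⊎ Cyclic p (prev u) q)
  arcWithin-bounds zero {p} {q} (inj₁ (_ , () , _))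
  arcWithin-bounds zero {p} {q} (inj₂ (q<p , _)) = last≢0 , upper , lower
    where
    p≤last : p Fin.≤ fromℕ m
    p≤last = ≡.subst (toℕ p ℕ.≤_) (≡.sym (toℕ-fromℕ m)) (toℕ≤pred[n] p)
    q<last : q Fin.< fromℕ m
    q<last = ℕ.<-≤-trans q<p p≤last
    last≢0 : fromℕ m ≢ zero
    last≢0 last≡0 = ℕ.n≮0 (≡.subst (q Fin.<_) last≡0 q<last)
    upper : zero ≡ q ⊎ Cyclic (fromℕ m) zero q
    upper with ≤⇒≡⊎< {zero} {q} z≤n
    ... | inj₁ 0≡q = inj₁ 0≡q
    ... | inj₂ 0<q = inj₂ (inj₂ (inj₁ (0<q , q<last)))
    lower : p ≡ fromℕ m ⊎ Cyclic p (fromℕ m) q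
    lower with ≤⇒≡⊎< p≤last
    ... | inj₁ p≡last = inj₁ p≡last
    ... | inj₂ p<last = inj₂ (inj₂ (inj₂ (q<p , p<last)))
  arcWithin-bounds (suc i) {p} {q} within = prev≢ , upper within , lower within
    where
    u : Fin (suc m)
    u = suc i
    prev<u : inject₁ i Fin.< u
    prev<u = s≤s (ℕ.≤-reflexive (toℕ-inject₁ i))
    prev≢ : inject₁ i ≢ u
    prev≢ eq = ℕ.<⇒≢ prev<u (≡.cong toℕ eq)
    ≤prev : ∀ {j : Fin (suc m)} → j Fin.< u → j Fin.≤ inject₁ i
    ≤prev {j} j<u = ≡.subst (toℕ j ℕ.≤_) (≡.sym (toℕ-inject₁ i)) (ℕ.s≤s⁻¹ j<u)
    upper : ArcWithin u p q → u ≡ q ⊎ Cyclic (inject₁ i) u q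
    upper (inj₁ (_ , _ , u≤q)) with ≤⇒≡⊎< u≤q
    ... | inj₁ u≡q = inj₁ u≡q
    ... | inj₂ u<q = inj₂ (inj₁ (prev<u , u<q))
    upper (inj₂ (_ , inj₁ u≤q)) with ≤⇒≡⊎< u≤q
    ... | inj₁ u≡q = inj₁ u≡q
    ... | inj₂ u<q = inj₂ (inj₁ (prev<u , u<q))
    upper (inj₂ (q<p , inj₂ p<u)) = inj₂ (inj₂ (inj₂ (ℕ.<-≤-trans q<p (≤prev p<u) , prev<u)))
    lower : ArcWithin u p q → p ≡ inject₁ i ⊎ Cyclic p (inject₁ i) q
    lower (inj₁ (_ , p<u , u≤q)) with ≤⇒≡⊎< (≤prev p<u)
    ... | inj₁ p≡prev = inj₁ p≡prev
    ... | inj₂ p<prev = inj₂ (inj₁ (p<prev , ℕ.<-≤-trans prev<u u≤q))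
    lower (inj₂ (q<p , inj₁ u≤q)) = inj₂ (inj₂ (inj₁ (ℕ.<-≤-trans prev<u u≤q , q<p)))
    lower (inj₂ (q<p , inj₂ p<u)) with ≤⇒≡⊎< (≤prev p<u)
    ... | inj₁ p≡prev = inj₁ p≡prev
    ... | inj₂ p<prev = inj₂ (inj₂ (inj₂ (q<p , p<prev)))

-- Regions and the sides of chords.

module Regions {c ℓ₁ ℓ₂} (K : OrderedField c ℓ₁ ℓ₂) {m : ℕ}
               (P : Plane.CirclePoints K (suc m))
               {l ℓ} (G : LabelledGraph (suc m) l ℓ)
               (G-sym : ∀ {e x y} → G e x y → G e y x)
               (G-irrefl : ∀ {e x y} → G e x y → x ≢ y) where
  open OrderedField K hiding (zero)
  open Plane K
  open CirclePoints P
  open ChordDiagram K P G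
  open Star using (ε; _◅_)
  open IntegerSolver K
  open OrderedFieldProperties K
  open PlaneProperties K

  side : Fin (suc m) → Fin (suc m) → Point → Carrier
  side p q = orient (point p) (point q)

  side-swap : ∀ p q z → side q p z ≈ - side p q z
  side-swap p q = orient-swap (point p) (point q)

  clockwise-point : ∀ {i j k} → Cyclic i j k → Clockwise (point i) (point j) (point k)
  clockwise-point (inj₁ (i<j , j<k)) = clockwise i<j j<k
  clockwise-point {i} {j} {k} (inj₂ (inj₁ (j<k , k<i))) =
    clockwise-rotate {point k} {point i} {point j}
      (clockwise-rotate {point j} {point k} {point i} (clockwise j<k k<i))
  clockwise-point {i} {j} {k} (inj₂ (inj₂ (k<i , i<j))) =
    clockwise-rotate {point k} {point i} {point j} (clockwise k<i i<j)

  clockwise⇒side-positive : ∀ p q z → Clockwise (point p) z (point q) → Positive (side p q z)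
  clockwise⇒side-positive p q z pzq = positive-resp
    (sym (orient-swapʳ (point p) z (point q))) (negative⇒positive pzq)

  -- The arc from `prev u` to u is enlarged first at its end to q, then at its start to p. Since
  -- transitivity keeps the first point fixed, the second enlargement rotates the cycle to begin at
  -- q.
  arc-clockwise : ∀ {u p q a} → ArcWithin u p q → arc u a → Clockwise (point p) a (point q)
  arc-clockwise {u} {p} {q} {a} within (a∈ , _ , _ , between) = extend-start p-bound (extend-end q-bound)
    where
    bounds = arcWithin-bounds u within
    q-bound = proj₁ (proj₂ bounds)
    p-bound = proj₂ (proj₂ bounds)
    extend-end : u ≡ q ⊎ Cyclic (prev u) u q → Clockwise (point (prev u)) a (point q)
    extend-end (inj₁ ≡.refl) = between (distinct (proj₁ bounds))
    extend-end (inj₂ cyc) = clockwise-trans {point (prev u)} {a} {point u} {point q}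
      (onCircle _) a∈ (onCircle _) (onCircle _) (between (distinct (proj₁ bounds))) (clockwise-point cyc)
    extend-start : p ≡ prev u ⊎ Cyclic p (prev u) q → Clockwise (point (prev u)) a (point q) →
      Clockwise (point p) a (point q)
    extend-start (inj₁ ≡.refl) vaq = vaq
    extend-start (inj₂ cyc) vaq = clockwise-rotate {point q} {point p} {a}
      (clockwise-trans {point q} {point p} {point (prev u)} {a}
        (onCircle _) (onCircle _) (onCircle _) a∈
        (clockwise-rotate {point (prev u)} {point q} {point p}
          (clockwise-rotate {point p} {point (prev u)} {point q} (clockwise-point cyc)))
        (clockwise-rotate {a} {point q} {point (prev u)}
          (clockwise-rotate {point (prev u)} {a} {point q} vaq)))

  arc-side : ∀ {u p q a} → ArcWithin u p q → arc u a → Positive (side p q a)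
  arc-side {u} {p} {q} {a} within a∈ =
    clockwise⇒side-positive p q a (arc-clockwise {u} {p} {q} {a} within a∈)

  onChord⇒inDisk : ∀ {e z} → OnChord e z → InDisk z
  onChord⇒inDisk (x , y , _ , xyz) =
    inDisk-convex {point x} {point y} (inj₂ (onCircle x)) (inj₂ (onCircle y)) xyz

  offChords⇒side≉0 : ∀ {e p q z} → G e p q → OffChords z → ¬ (side p q z ≈ 0#)
  offChords⇒side≉0 {e} {p} {q} {z} epq (z∈ , off) pqz≈0 = off e (p , q , epq ,
    orient≈0⇒segment (point p) (point q) z (onCircle p) (onCircle q) (distinct (G-irrefl epq)) z∈ pqz≈0)

  -- On a change of sign the segment would meet the line of the chord, and inside the disk this line
  -- is the chord itself.
  visible-side : ∀ {e p q z w} → G e p q → Visible z w → Positive (side p q z) → Positive (side p q w)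
  visible-side {e} {p} {q} {z} {w} epq vis 0≺z = [ positive , crosses ]′ (sign (- side p q w))
    where
    positive : Positive (- (- side p q w)) → Positive (side p q w)
    positive = positive-resp (solve 1 (λ x → :- (:- x) := x) refl (side p q w))
    crosses : NonNegative (- side p q w) → Positive (side p q w)
    crosses 0≼-w =
      let v , zwv , pqv≈0 = crossing (point p) (point q) z w 0≺z 0≼-w
      in contradiction pqv≈0 (offChords⇒side≉0 {z = v} epq (vis v zwv))

  joined-side : ∀ {e p q z w} → G e p q → Joined z w → Positive (side p q z) → Positive (side p q w)
  joined-side epq ε 0≺z = 0≺z
  joined-side {z = z} {w} epq (_◅_ {j = v} vis joined) 0≺z =
    joined-side {z = v} {w} epq joined (visible-side {z = z} {v} epq vis 0≺z)

  -- Half-planes and the disk are convex. The negative side of a chord is expressed as the positive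
  -- side of the reversed chord.
  sameSide⇒visible : ∀ {z w} → InDisk z → InDisk w →
    (∀ {e p q} → G e p q → (Positive (side p q z) × Positive (side p q w)) ⊎
                           (Positive (side q p z) × Positive (side q p w))) →
    Visible z w
  sameSide⇒visible {z} {w} z∈ w∈ same v zwv@(t , 0≼t , t≼1 , _) = inDisk-convex {z} {w} {v} z∈ w∈ zwv , off
    where
    positive-at-v : ∀ p q → Positive (side p q z) → Positive (side p q w) → Positive (side p q v)
    positive-at-v p q 0≺z 0≺w = positive-resp (sym (orient-segment (point p) (point q) {z} {w} {v} zwv))
      (positive-convex 0≺z 0≺w 0≼t t≼1)
    off : ∀ e → ¬ OnChord e v
    off e (p , q , epq , pqv) with same epq
    ... | inj₁ (0≺z , 0≺w) = positive-≉0 (positive-at-v p q 0≺z 0≺w)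
      (segment⇒orient≈0 (point p) (point q) {v} pqv)
    ... | inj₂ (0≺z , 0≺w) = positive-≉0 (positive-at-v q p 0≺z 0≺w) (trans (side-swap p q v)
      (trans (-‿cong (segment⇒orient≈0 (point p) (point q) {v} pqv)) (solve 0 (:- con 0ℤ := con 0ℤ) refl)))

  ¬cyclic⇒side-nonNegative : ∀ {p q} v → p ≢ q → ¬ Cyclic q v p → NonNegative (side p q (point v))
  ¬cyclic⇒side-nonNegative {p} {q} v p≢q ¬qvp with v ≟ p | v ≟ q
  ... | yes ≡.refl | _          = inj₂ (sym (orient-start (point p) (point q)))
  ... | no _       | yes ≡.refl = inj₂ (sym (orient-end (point p) (point q)))
  ... | no v≢p     | no v≢q with cyclic-total p≢q v≢p v≢q
  ...   | inj₁ pvq = inj₁ (clockwise⇒side-positive p q (point v) (clockwise-point pvq))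
  ...   | inj₂ qvp = contradiction qvp ¬qvp

  -- If an end v of e were strictly beyond f, so would be a whole neighbourhood of v. But this
  -- neighbourhood contains points of region u, and they are joined to arc u without crossing f.
  onBoundary⇒facing : ∀ {e u} → ChordOnBoundary e u → Facing G e u
  onBoundary⇒facing {e} {u} boundary {f} {p} {q} {v} {w} fpq evw within qvp =
    let δ , 0≺δ , near⇒positive = orient-positive-open (point q) (point p) (point v)
          (clockwise⇒side-positive q p (point v) (clockwise-point qvp))
        z , near , _ , a , a∈ , joined =
          proj₁ (boundary (point v) (v , w , evw , segment-start (point v) (point w)) δ 0≺δ)
    in positive-asym
      (joined-side {z = a} {z} fpq joined (arc-side {u} {p} {q} {a} within a∈))
      (positive-resp (side-swap p q z) (near⇒positive z near))

  -- A point a of arc u sees every point near a point z of the chord on the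
  -- segment from a to z.
  facing⇒onBoundary : ∀ {e u} → Facing G e u → ChordOnBoundary e u
  facing⇒onBoundary {e} {u} facing z z∈e@(x , y , exy , xyz@(τ , 0≼τ , τ≼1 , _)) δ 0≺δ =
    (w , z-near-w , w-off , a , a∈ , vis ◅ ε) , (z , near-refl δ z 0≺δ , λ ((_ , off) , _) → off e z∈e)
    where
    -- The chord e has two distinct ends, so there are at least two points on the circle and arc u
    -- is not the degenerate one.
    prev≢u : prev u ≢ u
    prev≢u = [ proj₁ ∘ arcWithin-bounds u , proj₁ ∘ arcWithin-bounds u ]′
      (arcWithin-total u (G-irrefl exy))

    a-exists : ∃[ a ] arc u a
    a-exists = arc-inhabited (point (prev u)) (point u) (onCircle _) (onCircle _) (distinct prev≢u)

    a = proj₁ a-exists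
    a∈ = proj₂ a-exists

    w-exists : ∃[ t ] Positive t × t ≼ 1# × Near δ z (along z a t)
    w-exists = near-along δ z a 0≺δ

    t = proj₁ w-exists
    0≺t = proj₁ (proj₂ w-exists)
    t≼1 = proj₁ (proj₂ (proj₂ w-exists))

    w : Point
    w = along z a t
    z-near-w = proj₂ (proj₂ (proj₂ w-exists))

    zaw : Segment z a w
    zaw = t , inj₁ 0≺t , t≼1 , refl , refl

    a-inDisk : InDisk a
    a-inDisk = inj₂ (proj₁ a∈)

    w-inDisk : InDisk w
    w-inDisk = inDisk-convex {z} {a} {w} (onChord⇒inDisk z∈e) a-inDisk zaw

    positive-at-w : ∀ {f p q} → G f p q → ArcWithin u p q → Positive (side p q w)
    positive-at-w {f} {p} {q} fpq within = positive-resp (sym (orient-along (point p) (point q) z a t))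
      (nonNegative+positive
        (nonNegative*nonNegative (≼⇒nonNegative t≼1) z-nonNegative)
        (*-positive 0≺t (arc-side {u} {p} {q} {a} within a∈)))
      where
      p≢q = G-irrefl fpq
      z-nonNegative : NonNegative (side p q z)
      z-nonNegative = nonNegative-resp (sym (orient-segment (point p) (point q) {point x} {point y} {z} xyz))
        (nonNegative+nonNegative
          (nonNegative*nonNegative (≼⇒nonNegative τ≼1) (¬cyclic⇒side-nonNegative x p≢q (facing fpq exy within)))
          (nonNegative*nonNegative 0≼τ (¬cyclic⇒side-nonNegative y p≢q (facing fpq (G-sym exy) within))))

    same : ∀ {f p q} → G f p q → (Positive (side p q a) × Positive (side p q w)) ⊎
                                  (Positive (side q p a) × Positive (side q p w))
    same {f} {p} {q} fpq =
      [ (λ within → inj₁ (arc-side {u} {p} {q} {a} within a∈ , positive-at-w fpq within))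
      , (λ within → inj₂ (arc-side {u} {q} {p} {a} within a∈ , positive-at-w (G-sym fpq) within))
      ]′ (arcWithin-total u (G-irrefl fpq))

    vis : Visible a w
    vis = sameSide⇒visible {a} {w} a-inDisk w-inDisk same

    w-off : OffChords w
    w-off = vis w (segment-end a w)

-- Graphs with too few edges to be connected.

open ≡ using (refl; sym; trans; cong; subst)

-- Disconnectedness in positive form: the two colour classes are nonempty and no edge joins them.
-- Loops and repeated edges are allowed.
NonConstantColouring : ∀ {n r} → (Fin r → Fin n) → (Fin r → Fin n) → Set
NonConstantColouring {n} x y =
  ∃ λ (f : Fin n → Bool) → (∀ k → f (x k) ≡ f (y k)) × (∃[ p ] ∃[ q ] f p ≢ f q)

-- Induction on the number of edges: contract the first edge by deleting `y₀` and sending it to the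
-- image of `x₀`, colour the smaller graph, and pull the colouring back.
twoColouring : ∀ r (x y : Fin r → Fin (2 ℕ.+ r)) → NonConstantColouring x y
twoColouring zero x y = (λ { zero → true ; (suc _) → false }) , (λ ()) , zero , suc zero , λ ()
twoColouring (suc r) x y = pull-back (twoColouring r (contract ∘ x ∘ suc) (contract ∘ y ∘ suc))
  where
  x₀ = x zero
  y₀ = y zero

  -- Any point will do as the image of y₀ when x₀ = y₀.
  image-y₀ : Dec (y₀ ≡ x₀) → Fin (2 ℕ.+ r)
  image-y₀ (yes _)     = zero
  image-y₀ (no y₀≢x₀) = punchOut y₀≢x₀

  contract′ : ∀ {v} → Dec (y₀ ≡ v) → Fin (2 ℕ.+ r)
  contract′ (yes _)    = image-y₀ (y₀ ≟ x₀)
  contract′ (no y₀≢v) = punchOut y₀≢v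

  contract : Fin (3 ℕ.+ r) → Fin (2 ℕ.+ r)
  contract v = contract′ (y₀ ≟ v)

  contract-punchIn : ∀ w → contract (punchIn y₀ w) ≡ w
  contract-punchIn w with y₀ ≟ punchIn y₀ w
  ... | yes y₀≡ = contradiction (sym y₀≡) (punchInᵢ≢i y₀ w)
  ... | no y₀≢  = trans (punchOut-cong y₀ refl) (punchOut-punchIn y₀)

  contract-x₀ : (d : Dec (y₀ ≡ x₀)) → contract′ d ≡ image-y₀ (y₀ ≟ x₀)
  contract-x₀ (yes _) = refl
  contract-x₀ (no y₀≢x₀) with y₀ ≟ x₀
  ... | yes y₀≡x₀ = contradiction y₀≡x₀ y₀≢x₀
  ... | no _      = punchOut-cong y₀ refl

  contract-y₀ : (d : Dec (y₀ ≡ y₀)) → contract′ d ≡ image-y₀ (y₀ ≟ x₀)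
  contract-y₀ (yes _)     = refl
  contract-y₀ (no y₀≢y₀) = contradiction refl y₀≢y₀

  contract-edge : contract x₀ ≡ contract y₀
  contract-edge = trans (contract-x₀ (y₀ ≟ x₀)) (sym (contract-y₀ (y₀ ≟ y₀)))

  pull-back : NonConstantColouring (contract ∘ x ∘ suc) (contract ∘ y ∘ suc) → NonConstantColouring x y
  pull-back (f , f-edges , p , q , fp≢fq) =
    -- `punchIn y₀` is a section of `contract`, so both colours still occur.
    f ∘ contract , edges , punchIn y₀ p , punchIn y₀ q ,
    λ eq → fp≢fq (trans (sym (cong f (contract-punchIn p))) (trans eq (cong f (contract-punchIn q))))
    where
    edges : ∀ k → f (contract (x k)) ≡ f (contract (y k))
    edges zero    = cong f contract-edge
    edges (suc k) = f-edges k

-- Prefixes of the product.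

swap : ∀ {n} → Transposition n → Fin n → Fin n
swap t i = toPermutation t ⟨$⟩ʳ i

-- Labels start at 0, so time `toℕ k` is just before the transposition labelled k and time
-- `suc (toℕ k)` just after it.
state : ∀ {n m} → Vec (Transposition n) m → ℕ → Fin n → Fin n
state s       zero    u = u
state []      (suc i) u = u
state (t ∷ s) (suc i) u = state s i (swap t u)

state-product : ∀ {n m} (s : Vec (Transposition n) m) u → state s m u ≡ product s ⟨$⟩ʳ u
state-product []      u = refl
state-product (t ∷ s) u = state-product s (swap t u)

state-suc : ∀ {n m} (s : Vec (Transposition n) m) k u →
  state s (suc (toℕ k)) u ≡ swap (lookup s k) (state s (toℕ k) u)
state-suc (t ∷ s) zero    u = refl
state-suc (t ∷ s) (suc k) u = state-suc s k (swap t u)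

module _ {n} (t : Transposition n) where
  open Transposition t

  swap-x : swap t x ≡ y
  swap-x rewrite dec-true (x ≟ x) refl = refl

  swap-y : swap t y ≡ x
  swap-y rewrite dec-false (y ≟ x) (x≢y ∘ sym) | dec-true (y ≟ y) refl = refl

  swap-other : ∀ {i} → i ≢ x → i ≢ y → swap t i ≡ i
  swap-other {i} i≢x i≢y rewrite dec-false (i ≟ x) i≢x | dec-false (i ≟ y) i≢y = refl

  swap-involutive : ∀ i → swap t (swap t i) ≡ i
  swap-involutive i = cases (i ≟ x) (i ≟ y)
    where
    cases : Dec (i ≡ x) → Dec (i ≡ y) → swap t (swap t i) ≡ i
    cases (yes refl) _          = trans (cong (swap t) swap-x) swap-y
    cases (no _)     (yes refl) = trans (cong (swap t) swap-y) swap-x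
    cases (no i≢x)   (no i≢y)   = trans (cong (swap t) (swap-other i≢x i≢y)) (swap-other i≢x i≢y)

state-surjective : ∀ {n m} (s : Vec (Transposition n) m) i v → ∃[ u ] state s i u ≡ v
state-surjective s       zero    v = v , refl
state-surjective []      (suc i) v = v , refl
state-surjective (t ∷ s) (suc i) v =
  let u , eq = state-surjective s i v
  in swap t u , trans (cong (state s i) (swap-involutive t u)) eq

fromToℕ : ∀ {i m} → i ℕ.< m → ∃[ k ] toℕ {m} k ≡ i
fromToℕ i<m = fromℕ< i<m , toℕ-fromℕ< i<m

-- Greedy trails as walks under the prefixes of the product.

module Edges {n m} (s : Vec (Transposition n) m) where

  edge-sym : ∀ {k a b} → graph s k a b → graph s k b a
  edge-sym (inj₁ (a≡x , b≡y)) = inj₂ (b≡y , a≡x)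
  edge-sym (inj₂ (a≡y , b≡x)) = inj₁ (b≡x , a≡y)

  edge-irrefl : ∀ {k a b} → graph s k a b → a ≢ b
  edge-irrefl {k} (inj₁ (refl , b≡y)) refl = Transposition.x≢y (lookup s k) b≡y
  edge-irrefl {k} (inj₂ (refl , b≡x)) refl = Transposition.x≢y (lookup s k) (sym b≡x)

  edge-ends : ∀ {k a b v w} → graph s k a b → graph s k v w → v ≡ a ⊎ v ≡ b
  edge-ends (inj₁ (refl , refl)) (inj₁ (v≡x , _)) = inj₁ v≡x
  edge-ends (inj₁ (refl , refl)) (inj₂ (v≡y , _)) = inj₂ v≡y
  edge-ends (inj₂ (refl , refl)) (inj₁ (v≡x , _)) = inj₂ v≡x
  edge-ends (inj₂ (refl , refl)) (inj₂ (v≡y , _)) = inj₁ v≡y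

  ascendingEdge : ∀ k → ∃[ a ] ∃[ b ] graph s k a b × a Fin.< b
  ascendingEdge k with <-cmp x y
    where open Transposition (lookup s k)
  ... | tri< x<y _ _ = _ , _ , inj₁ (refl , refl) , x<y
  ... | tri≈ _ x≡y _ = contradiction x≡y (Transposition.x≢y (lookup s k))
  ... | tri> _ _ y<x = _ , _ , inj₂ (refl , refl) , y<x

  incident? : ∀ k v → Dec (∃[ w ] graph s k v w)
  incident? k v with v ≟ x | v ≟ y
    where open Transposition (lookup s k)
  ... | yes v≡x | _       = yes (_ , inj₁ (v≡x , refl))
  ... | no _    | yes v≡y = yes (_ , inj₂ (v≡y , refl))
  ... | no v≢x  | no v≢y  = no λ { (_ , inj₁ (v≡x , _)) → v≢x v≡x ; (_ , inj₂ (v≡y , _)) → v≢y v≡y }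

  swap-edge : ∀ {k a b} → graph s k a b → swap (lookup s k) a ≡ b
  swap-edge {k} (inj₁ (refl , refl)) = swap-x (lookup s k)
  swap-edge {k} (inj₂ (refl , refl)) = swap-y (lookup s k)

  swap-fixed : ∀ {k v} → ¬ (∃[ w ] graph s k v w) → swap (lookup s k) v ≡ v
  swap-fixed {k} free = swap-other (lookup s k)
    (λ v≡x → free (_ , inj₁ (v≡x , refl))) (λ v≡y → free (_ , inj₂ (v≡y , refl)))

  swap-invariant : ∀ {A : Set} (f : Fin n → A) {k a b} → graph s k a b → f a ≡ f b →
    ∀ v → f (swap (lookup s k) v) ≡ f v
  swap-invariant f {k} e fa≡fb v with incident? k v
  ... | no free = cong f (swap-fixed free)
  ... | yes (w , e′) with edge-ends e e′
  ...   | inj₁ refl = trans (cong f (swap-edge e)) (sym fa≡fb)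
  ...   | inj₂ refl = trans (cong f (swap-edge (edge-sym e))) fa≡fb

  -- Induction on the end time j. The condition on a swap may assume that v still has the initial
  -- colour; for `f = id` the swaps then have to fix only the vertex where the walk rests.
  state-invariant : ∀ {A : Set} (f : Fin n → A) {i} j → i ℕ.≤ j → j ℕ.≤ m → ∀ u →
    (∀ k → i ℕ.≤ toℕ k → toℕ k ℕ.< j → ∀ v → f v ≡ f (state s i u) → f (swap (lookup s k) v) ≡ f v) →
    f (state s j u) ≡ f (state s i u)
  state-invariant f zero z≤n _ u inv = refl
  state-invariant f {i} (suc j) i≤1+j j<m u inv with ℕ.m≤n⇒m<n∨m≡n i≤1+j
  ... | inj₂ refl = refl
  ... | inj₁ (s≤s i≤j) = trans (one-step (fromToℕ j<m)) ih
    where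
    ih : f (state s j u) ≡ f (state s i u)
    ih = state-invariant f j i≤j (ℕ.<⇒≤ j<m) u
      (λ k i≤k k<j → inv k i≤k (ℕ.m<n⇒m<1+n k<j))
    one-step : ∃[ k ] toℕ {m} k ≡ j → f (state s (suc j) u) ≡ f (state s j u)
    one-step (k , refl) = trans (cong f (state-suc s k u)) (inv k i≤j ℕ.≤-refl _ ih)

  state-free : ∀ k u → ¬ (∃[ w ] graph s k (state s (toℕ k) u) w) →
    state s (suc (toℕ k)) u ≡ state s (toℕ k) u
  state-free k u free = trans (state-suc s k u) (swap-fixed free)

  -- The walk of u is moved by the transposition labelled k. By `trailUses⇔uses` this is the use of
  -- edge k by the greedy trail.
  Uses : Fin m → Fin n → Set
  Uses k u = ∃[ w ] graph s k (state s (toℕ k) u) w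

  -- The swap exchanges the ends of edge k, so w is the position just before it.
  uses-suc : ∀ {k u w} → graph s k (state s (suc (toℕ k)) u) w → Uses k u
  uses-suc {k} {u} {w} e = _ , subst (λ v → graph s k v (state s (suc (toℕ k)) u)) w≡ (edge-sym e)
    where
    w≡ : w ≡ state s (toℕ k) u
    w≡ = trans (sym (swap-edge e))
      (trans (cong (swap (lookup s k)) (state-suc s k u)) (swap-involutive (lookup s k) _))

  uses-end : ∀ {k u v w} → Uses k u → graph s k v w →
    v ≡ state s (toℕ k) u ⊎ v ≡ state s (suc (toℕ k)) u
  uses-end {k} {u} (z , e) e′ with edge-ends e e′
  ... | inj₁ v≡ = inj₁ v≡
  ... | inj₂ refl = inj₂ (sym (trans (state-suc s k u) (swap-edge e)))

  open Trails (graph s)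

  -- At time i, with `used` labels below i, the trail of u is at state s i u.
  greedy-sound : ∀ {used v ks} → GreedyFrom used v ks → ∀ u i → v ≡ state s i u →
    All (λ l → toℕ l ℕ.< i) used → (∀ l → Available used v l → i ℕ.≤ toℕ l) →
    ∀ {k} → k ∈ ks → Uses k u
  greedy-sound {used} {v} (step {l} {w} av least e rest) u i refl used<i i≤av = λ where
      (here refl) → w , subst (λ v → graph s l v w) (sym stay) e
      (there k∈)  → greedy-sound rest u (suc (toℕ l))
        (trans (sym (swap-edge e)) (sym (trans (state-suc s l u) (cong (swap (lookup s l)) stay))))
        (ℕ.≤-refl ∷ All.map (λ {l′} l′<i → ℕ.m<n⇒m<1+n (ℕ.<-≤-trans l′<i (i≤av l av))) used<i)
        (λ { l′ (_ , l<l′ ∷ _) → l<l′ }) k∈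
    where
    -- An edge at the resting vertex with a label from `i` up to but excluding `l` would be
    -- available, against the minimality of `l`.
    stay : state s (toℕ l) u ≡ state s i u
    stay = state-invariant id (toℕ l) (i≤av l av) (ℕ.<⇒≤ (toℕ<n l)) u
      λ { l′ i≤l′ l′<l _ refl → swap-fixed λ e′ →
          ℕ.<⇒≱ l′<l (least l′ (e′ , All.map (λ k<i → ℕ.<-≤-trans k<i i≤l′) used<i)) }

  -- The labels are examined in increasing order, and `d` counts those still to come. The trail
  -- takes an edge exactly when it meets the current vertex, since it is then the least available
  -- one.
  greedy-complete : ∀ d used u i → i ℕ.+ d ≡ m →
    All (λ l → toℕ l ℕ.< i) used → (∀ l → Available used (state s i u) l → i ℕ.≤ toℕ l) →
    ∃[ ks ] GreedyFrom used (state s i u) ks × (∀ k → i ℕ.≤ toℕ k → Uses k u → k ∈ ks)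
  greedy-complete zero used u i i+0≡m used<i i≤av =
    [] , stop (λ l av → late l (i≤av l av)) , λ k i≤k _ → contradiction i≤k (late k)
    where
    late : ∀ k → ¬ (i ℕ.≤ toℕ k)
    late k i≤k = ℕ.<⇒≱ (toℕ<n k) (subst (ℕ._≤ toℕ k) (trans (sym (ℕ.+-identityʳ i)) i+0≡m) i≤k)
  greedy-complete (suc d) used u i i+1+d≡m used<i i≤av
    with l , refl ← fromToℕ {i} {m} (subst (i ℕ.<_) i+1+d≡m (ℕ.m<m+n i ℕ.z<s))
    with incident? l (state s (toℕ l) u)
  ... | yes (w , e)
      with ks , greedy , complete ← greedy-complete d (l ∷ used) u (suc (toℕ l))
             (trans (sym (ℕ.+-suc (toℕ l) d)) i+1+d≡m)
             (ℕ.≤-refl ∷ All.map ℕ.m<n⇒m<1+n used<i)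
             (λ { _ (_ , l<l′ ∷ _) → l<l′ })
      = l ∷ ks ,
        step ((w , e) , used<i) i≤av
          (subst (graph s l (state s (toℕ l) u)) (trans (sym (swap-edge e)) (sym (state-suc s l u))) e)
          greedy ,
        λ k l≤k uses → [ (λ l<k → there (complete k l<k uses)) , (λ l≡k → here (sym (toℕ-injective l≡k))) ]′
          (ℕ.m≤n⇒m<n∨m≡n l≤k)
  -- Label `l` misses the current vertex, so the walk stays there and the lower bound for available
  -- labels rises by one.
  ... | no free
      with ks , greedy , complete ← greedy-complete d used u (suc (toℕ l))
             (trans (sym (ℕ.+-suc (toℕ l) d)) i+1+d≡m)
             (All.map ℕ.m<n⇒m<1+n used<i)
             (λ l′ av → [ id , (λ l≡l′ → contradiction
               (subst (λ k → ∃[ w ] graph s k (state s (suc (toℕ l)) u) w) (sym (toℕ-injective l≡l′)) (proj₁ av))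
               (subst (λ v → ¬ (∃[ w ] graph s l v w)) (sym (state-free l u free)) free)) ]′
               (ℕ.m≤n⇒m<n∨m≡n (i≤av l′ (subst (λ v → Available used v l′) (state-free l u free) av))))
      = ks , subst (λ v → GreedyFrom used v ks) (state-free l u free) greedy ,
        λ k l≤k uses → [ (λ l<k → complete k l<k uses)
                       , (λ l≡k → contradiction (subst (λ k → Uses k u) (sym (toℕ-injective l≡k)) uses) free) ]′
          (ℕ.m≤n⇒m<n∨m≡n l≤k)

  trailUses⇔uses : ∀ {u k} → TrailUses u k ⇔ Uses k u
  trailUses⇔uses {u} {k} = mk⇔
    (λ (ks , greedy , k∈ks) → greedy-sound greedy u 0 refl [] (λ _ _ → z≤n) k∈ks)
    (λ uses → let ks , greedy , complete = greedy-complete m [] u 0 refl [] (λ _ _ → z≤n)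
              in ks , greedy , complete k z≤n uses)

-- Half-open intervals and separation by a chord.

Within⁻ Within⁺ : ∀ {n} → Fin n → Fin n → Fin n → Set
Within⁻ a b v = a Fin.≤ v × v Fin.< b
Within⁺ a b v = a Fin.< v × v Fin.≤ b

-- Links vertices to arcs: (a, b] contains u exactly when arc u lies between a and b, and the cycle
-- carries (a, b] onto [a, b). The vertex `zero` is in no (a, b], and its image, the last vertex, is
-- in no [a, b).
prev-within : ∀ {m} {a b : Fin (suc m)} v → Within⁻ a b (prev v) ⇔ Within⁺ a b v
prev-within {m} {b = b} zero = mk⇔
  (λ (_ , last<b) → contradiction (toℕ≤pred[n] b) (ℕ.<⇒≱ (subst (ℕ._< toℕ b) (toℕ-fromℕ m) last<b)))
  (λ { (() , _) })
prev-within {a = a} {b} (suc i) = mk⇔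
  (λ (a≤ , <b) → s≤s (subst (toℕ a ℕ.≤_) (toℕ-inject₁ i) a≤) , subst (ℕ._< toℕ b) (toℕ-inject₁ i) <b)
  (λ (a< , ≤b) → subst (toℕ a ℕ.≤_) (sym (toℕ-inject₁ i)) (ℕ.s≤s⁻¹ a<) ,
                 subst (ℕ._< toℕ b) (sym (toℕ-inject₁ i)) ≤b)

within⁻? : ∀ {n} (a b v : Fin n) → Dec (Within⁻ a b v)
within⁻? a b v = (a ≤? v) ×-dec (v <? b)

within⁺? : ∀ {n} (a b v : Fin n) → Dec (Within⁺ a b v)
within⁺? a b v = (a <? v) ×-dec (v ≤? b)

-- `Facing`, with every chord f = {a, b} given by its ends in ascending order.
NotSeparated : ∀ {n l ℓ} → LabelledGraph n l ℓ → Fin l → Fin n → Set ℓ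
NotSeparated G e u = ∀ {f a b v w} → G f a b → a Fin.< b → G e v w →
  (Within⁺ a b u → a Fin.≤ v × v Fin.≤ b) × (a Fin.< v → v Fin.< b → Within⁺ a b u)

notSeparated⇒facing : ∀ {n l ℓ} {G : LabelledGraph n l ℓ} → (∀ {e x y} → G e x y → G e y x) →
  ∀ {e u} → NotSeparated G e u → Facing G e u
notSeparated⇒facing G-sym weak f-edge e-edge (inj₁ (p<q , inside)) cyc
  with proj₁ (weak f-edge p<q e-edge) inside | cyc
... | p≤v , v≤q | inj₁ (q<v , _)        = ℕ.<⇒≱ q<v v≤q
... | p≤v , v≤q | inj₂ (inj₁ (v<p , _)) = ℕ.<⇒≱ v<p p≤v
... | p≤v , v≤q | inj₂ (inj₂ (_ , q<v)) = ℕ.<⇒≱ q<v v≤q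
notSeparated⇒facing G-sym weak f-edge e-edge (inj₂ (q<p , outside)) = λ where
  (inj₁ (q<v , v<p)) → let q<u , u≤p = proj₂ (weak (G-sym f-edge) q<p e-edge) q<v v<p in
    [ ℕ.<⇒≱ q<u , (λ p<u → ℕ.<⇒≱ p<u u≤p) ]′ outside
  (inj₂ (inj₁ (_ , p<q))) → ℕ.<-asym p<q q<p
  (inj₂ (inj₂ (p<q , _))) → ℕ.<-asym p<q q<p

facing⇒notSeparated : ∀ {n l ℓ} {G : LabelledGraph n l ℓ} → (∀ {e x y} → G e x y → G e y x) →
  ∀ {e u} → Facing G e u → NotSeparated G e u
facing⇒notSeparated G-sym {u = u} facing {f} {a} {b} f-edge a<b e-edge =
  (λ inside → let facing′ = facing f-edge e-edge (inj₁ (a<b , inside)) in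
    ℕ.≮⇒≥ (λ v<a → facing′ (inj₂ (inj₁ (v<a , a<b)))) ,
    ℕ.≮⇒≥ (λ b<v → facing′ (inj₂ (inj₂ (a<b , b<v))))) ,
  λ a<v v<b → [ proj₂
              , (λ arc → contradiction (inj₁ (a<v , v<b)) (facing (G-sym f-edge) e-edge arc)) ]′
    (split a<v v<b)
  where
  split : ∀ {v} → a Fin.< v → v Fin.< b → (a Fin.< b × Within⁺ a b u) ⊎ ArcWithin u b a
  split _ _ with arcWithin-total u {a} {b} (λ { refl → ℕ.<-irrefl refl a<b })
  ... | inj₁ (inj₁ within) = inj₁ within
  ... | inj₁ (inj₂ (b<a , _)) = contradiction a<b (ℕ.<-asym b<a)
  ... | inj₂ within = inj₂ within

-- Minimal factorisations of the cycle.

module Factorisation {r} (s : Vec (Transposition (2 ℕ.+ r)) (suc r)) (s∈𝓕 : In𝓕 s) where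
  open Edges s

  edge-xy : ∀ k → let open Transposition (lookup s k) in graph s k x y
  edge-xy k = inj₁ (refl , refl)

  state-all : ∀ u → state s (suc r) u ≡ prev u
  state-all u = trans (state-product s u) (s∈𝓕 u)

  -- Moving s_j to the front of the sequence conjugates the earlier
  -- transpositions by s_j. The other n-2 transpositions do not connect all
  -- vertices, hence the colouring f.
  record Colouring (j : Fin (suc r)) : Set where
    field
      f           : Fin (2 ℕ.+ r) → Bool
      early       : ∀ {k} → k Fin.< j → let open Transposition (lookup s k) in
                    f (swap (lookup s j) x) ≡ f (swap (lookup s j) y)
      late        : ∀ {k} → j Fin.< k → let open Transposition (lookup s k) in f x ≡ f y
      nonconstant : ∃[ p ] ∃[ q ] f p ≢ f q

  -- `punchIn j` runs through the labels other than j, which leaves r edges on r + 2 vertices for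
  -- `twoColouring`.
  colouring : ∀ j → Colouring j
  colouring j = fromTwoColouring
    (twoColouring r (end Transposition.x ∘ punchIn j) (end Transposition.y ∘ punchIn j))
    where
    conjugate : ∀ {k} → Dec (k Fin.< j) → Fin (2 ℕ.+ r) → Fin (2 ℕ.+ r)
    conjugate (yes _) = swap (lookup s j)
    conjugate (no _)  = id

    end : (Transposition (2 ℕ.+ r) → Fin (2 ℕ.+ r)) → Fin (suc r) → Fin (2 ℕ.+ r)
    end g k = conjugate (k <? j) (g (lookup s k))

    fromTwoColouring :
      NonConstantColouring (end Transposition.x ∘ punchIn j) (end Transposition.y ∘ punchIn j) → Colouring j
    fromTwoColouring (f , f-edges , nonconstant) = record
      { f = f
      ; early = λ {k} k<j → early (k <? j) k<j (f-edge (ℕ.<⇒≢ k<j ∘ sym ∘ cong toℕ))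
      ; late  = λ {k} j<k → late (k <? j) j<k (f-edge (ℕ.<⇒≢ j<k ∘ cong toℕ))
      ; nonconstant = nonconstant
      }
      where
      f-edge : ∀ {k} → j ≢ k → f (end Transposition.x k) ≡ f (end Transposition.y k)
      f-edge j≢k = subst (λ k → f (end Transposition.x k) ≡ f (end Transposition.y k))
        (punchIn-punchOut j≢k) (f-edges (punchOut j≢k))
      early : ∀ {k a b} (k<j? : Dec (k Fin.< j)) → k Fin.< j →
        f (conjugate k<j? a) ≡ f (conjugate k<j? b) → f (swap (lookup s j) a) ≡ f (swap (lookup s j) b)
      early (yes _)  _   eq = eq
      early (no k≮j) k<j _  = contradiction k<j k≮j
      late : ∀ {k a b} (k<j? : Dec (k Fin.< j)) → j Fin.< k →
        f (conjugate k<j? a) ≡ f (conjugate k<j? b) → f a ≡ f b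
      late (yes k<j) j<k _  = contradiction k<j (ℕ.<-asym j<k)
      late (no _)    _   eq = eq

  module _ (j : Fin (suc r)) where
    open Colouring (colouring j)

    late-state : ∀ {i} → toℕ j ℕ.< i → i ℕ.≤ suc r → ∀ u → f (state s i u) ≡ f (prev u)
    late-state {i} j<i i≤m u = trans (sym (state-invariant f (suc r) i≤m ℕ.≤-refl u
      λ k i≤k _ v _ → swap-invariant f (edge-xy k) (late (ℕ.<-≤-trans j<i i≤k)) v))
      (cong f (state-all u))

    -- Before time j the conjugated colouring is invariant. At time j the transposition itself turns
    -- it into `f`, and `late-state` takes over.
    early-state : ∀ {i} → i ℕ.≤ toℕ j → ∀ u → f (swap (lookup s j) (state s i u)) ≡ f (prev u)
    early-state {i} i≤j u = trans
      (sym (state-invariant (f ∘ swap (lookup s j)) (toℕ j) i≤j (ℕ.<⇒≤ (toℕ<n j)) u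
        λ k _ k<j v _ → swap-invariant (f ∘ swap (lookup s j)) (edge-xy k) (early k<j) v))
      (trans (cong f (sym (state-suc s j u))) (late-state ℕ.≤-refl (toℕ<n j) u))

    -- This is time 0. It makes `f` constant on the cycles of sⱼ followed by the whole product,
    -- which are [a, b) and its complement.
    swap-prev : ∀ u → f (swap (lookup s j) u) ≡ f (prev u)
    swap-prev = early-state z≤n

    module _ {a b} (e : graph s j a b) (a<b : a Fin.< b) where

      f-prev : ∀ {v} → v ≢ a → v ≢ b → f v ≡ f (prev v)
      f-prev {v} v≢a v≢b = trans (cong f (sym (swap-fixed λ (_ , e′) → [ v≢a , v≢b ]′ (edge-ends e e′))))
        (swap-prev v)

      f-inside : ∀ v → Within⁻ a b v → f v ≡ f a
      f-inside = <-weakInduction (λ v → Within⁻ a b v → f v ≡ f a)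
        (λ (a≤0 , _) → cong f (toℕ-injective (sym (ℕ.n≤0⇒n≡0 a≤0))))
        inductive-step
        where
        inductive-step : ∀ i → (Within⁻ a b (inject₁ i) → f (inject₁ i) ≡ f a) →
          Within⁻ a b (suc i) → f (suc i) ≡ f a
        inductive-step i ih (a≤ , <b) with ℕ.m≤n⇒m<n∨m≡n a≤
        ... | inj₂ a≡ = cong f (toℕ-injective (sym a≡))
        ... | inj₁ a< = trans
          (f-prev (λ { refl → ℕ.<-irrefl refl a< }) (λ { refl → ℕ.<-irrefl refl <b }))
          (ih (from (prev-within (suc i)) (a< , ℕ.<⇒≤ <b)))

      f-above : ∀ v → b Fin.≤ v → f v ≡ f b
      f-above = <-weakInduction (λ v → b Fin.≤ v → f v ≡ f b)
        (λ b≤0 → contradiction (ℕ.<-≤-trans a<b b≤0) ℕ.n≮0)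
        inductive-step
        where
        inductive-step : ∀ i → (b Fin.≤ inject₁ i → f (inject₁ i) ≡ f b) → b Fin.≤ suc i → f (suc i) ≡ f b
        inductive-step i ih b≤ with ℕ.m≤n⇒m<n∨m≡n b≤
        ... | inj₂ b≡ = cong f (toℕ-injective (sym b≡))
        ... | inj₁ b< = trans
          (f-prev (λ { refl → ℕ.<-asym b< a<b }) (λ { refl → ℕ.<-irrefl refl b< }))
          (ih (subst (toℕ b ℕ.≤_) (sym (toℕ-inject₁ i)) (ℕ.s≤s⁻¹ b<)))

      f-below : ∀ v → v Fin.< a → f v ≡ f b
      f-below = <-weakInduction (λ v → v Fin.< a → f v ≡ f b)
        -- Downwards from `zero` the cycle continues at the last vertex, which is not below b.
        (λ 0<a → trans (f-prev (λ { refl → ℕ.n≮0 0<a }) (λ { refl → ℕ.n≮0 a<b }))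
          (f-above (fromℕ (suc r)) (subst (toℕ b ℕ.≤_) (sym (toℕ-fromℕ (suc r))) (toℕ≤pred[n] b))))
        (λ i ih i<a → trans
          (f-prev (λ { refl → ℕ.<-irrefl refl i<a }) (λ { refl → ℕ.<-asym i<a a<b }))
          (ih (subst (ℕ._< toℕ a) (sym (toℕ-inject₁ i)) (ℕ.<⇒≤ i<a))))

      f-outside : ∀ v → ¬ Within⁻ a b v → f v ≡ f b
      f-outside v outside with ℕ.<-≤-connex (toℕ v) (toℕ a) | ℕ.<-≤-connex (toℕ v) (toℕ b)
      ... | inj₁ v<a | _        = f-below v v<a
      ... | inj₂ a≤v | inj₁ v<b = contradiction (a≤v , v<b) outside
      ... | inj₂ _   | inj₂ b≤v = f-above v b≤v

      fa≢fb : f a ≢ f b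
      fa≢fb fa≡fb = let p , q , fp≢fq = nonconstant in fp≢fq (trans (constant p) (sym (constant q)))
        where
        constant : ∀ v → f v ≡ f b
        constant v with within⁻? a b v
        ... | yes inside = trans (f-inside v inside) fa≡fb
        ... | no outside = f-outside v outside

      f-reflects-within : ∀ {v w} → f v ≡ f w → Within⁻ a b v → Within⁻ a b w
      f-reflects-within {v} {w} fv≡fw inside with within⁻? a b w
      ... | yes w-inside = w-inside
      ... | no w-outside = contradiction
        (trans (sym (f-inside v inside)) (trans fv≡fw (f-outside w w-outside))) fa≢fb

      -- After time j the position keeps the colour of `prev u`, and the colour decides membership
      -- in [a, b).
      within-late-state : ∀ {i} → toℕ j ℕ.< i → i ℕ.≤ suc r → ∀ u →
        Within⁻ a b (state s i u) ⇔ Within⁺ a b u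
      within-late-state j<i i≤m u = mk⇔
        (to (prev-within u) ∘ f-reflects-within (late-state j<i i≤m u))
        (f-reflects-within (sym (late-state j<i i≤m u)) ∘ from (prev-within u))

      -- Up to time j it is the colour of `prev` of the position that is preserved, so (a, b]
      -- appears on both sides.
      within-early-state : ∀ {i} → i ℕ.≤ toℕ j → ∀ u → Within⁺ a b (state s i u) ⇔ Within⁺ a b u
      within-early-state {i} i≤j u = mk⇔
        (to (prev-within u) ∘ f-reflects-within eq ∘ from (prev-within (state s i u)))
        (to (prev-within (state s i u)) ∘ f-reflects-within (sym eq) ∘ from (prev-within u))
        where
        eq : f (prev (state s i u)) ≡ f (prev u)
        eq = trans (sym (swap-prev (state s i u))) (early-state i≤j u)

  -- The ends of edge k are the positions of u just before and just after swap k. For j before k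
  -- their membership in [a, b) is that of arc u between a and b, for j after k their membership in
  -- (a, b]. Either implies the weak form, in which ends of k may coincide with a or b.
  uses⇒notSeparated : ∀ {k u} → Uses k u → NotSeparated (graph s) k u
  uses⇒notSeparated {k} {u} uses {j} {a} {b} {v} j-edge a<b k-edge with <-cmp j k
  ... | tri< j<k _ _ =
    (λ inside → let a≤v , v<b = from v⇔u inside in a≤v , ℕ.<⇒≤ v<b) ,
    λ a<v v<b → to v⇔u (ℕ.<⇒≤ a<v , v<b)
    where
    v⇔u : Within⁻ a b v ⇔ Within⁺ a b u
    v⇔u with uses-end uses k-edge
    ... | inj₁ refl = within-late-state j j-edge a<b j<k (ℕ.<⇒≤ (toℕ<n k)) u
    ... | inj₂ refl = within-late-state j j-edge a<b (ℕ.m<n⇒m<1+n j<k) (toℕ<n k) u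
  ... | tri> _ _ k<j =
    (λ inside → let a<v , v≤b = from v⇔u inside in ℕ.<⇒≤ a<v , v≤b) ,
    λ a<v v<b → to v⇔u (a<v , ℕ.<⇒≤ v<b)
    where
    v⇔u : Within⁺ a b v ⇔ Within⁺ a b u
    v⇔u with uses-end uses k-edge
    ... | inj₁ refl = within-early-state j j-edge a<b (ℕ.<⇒≤ k<j) u
    ... | inj₂ refl = within-early-state j j-edge a<b k<j u
  ... | tri≈ _ refl _ with edge-ends j-edge k-edge
  ...   | inj₁ refl = (λ _ → ℕ.≤-refl , ℕ.<⇒≤ a<b) , λ a<a _ → contradiction refl (ℕ.<⇒≢ a<a)
  ...   | inj₂ refl = (λ _ → ℕ.<⇒≤ a<b , ℕ.≤-refl) , λ _ b<b → contradiction refl (ℕ.<⇒≢ b<b)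

  -- Otherwise the indicator function of [u, w) would be constant on all
  -- edges, hence invariant under the cycle.
  arcs-separated : ∀ {u w} → u Fin.< w →
    ¬ (∀ {j a b} → graph s j a b → a Fin.< b → Within⁺ a b u ⇔ Within⁺ a b w)
  arcs-separated {u} {w} u<w same = contradiction
    (trans (sym (dec-true (within⁻? u w (prev w)) (from (prev-within w) (u<w , ℕ.≤-refl))))
      (trans (indicator-prev w) (dec-false (within⁻? u w w) (λ (_ , w<w) → ℕ.<-irrefl refl w<w))))
    λ ()
    where
    indicator : Fin (2 ℕ.+ r) → Bool
    indicator v = does (within⁻? u w v)

    -- An edge leaving [u, w) would have exactly one of the arcs u and w between its ends.
    endpoints : ∀ {j a b} → graph s j a b → a Fin.< b → Within⁻ u w a ⇔ Within⁻ u w b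
    endpoints e a<b = mk⇔
      (λ (u≤a , a<w) → ℕ.≤-trans u≤a (ℕ.<⇒≤ a<b) ,
        ℕ.≰⇒> (λ w≤b → ℕ.<⇒≱ (proj₁ (from (same e a<b) (a<w , w≤b))) u≤a))
      (λ (u≤b , b<w) →
        ℕ.≮⇒≥ (λ a<u → ℕ.<⇒≱ b<w (proj₂ (to (same e a<b) (a<u , u≤b)))) , ℕ.<-trans a<b b<w)

    indicator-prev : ∀ v → indicator (prev v) ≡ indicator v
    indicator-prev v = trans (cong indicator (sym (state-all v)))
      (state-invariant indicator (suc r) z≤n ℕ.≤-refl v λ k _ _ v′ _ →
        let a , b , e , a<b = ascendingEdge k in
        swap-invariant indicator e (does-⇔ (endpoints e a<b) (within⁻? u w a) (within⁻? u w b)) v′)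

  -- Suppose arc u is between c and d but arc w is not. Then the ends of k are in [c, d] because of
  -- u and not strictly inside because of w. They are thus c and d themselves, and the assumption on
  -- edge k settles the case.
  notSeparated-edge : ∀ {j k a b c d u w} → graph s k a b → a Fin.< b → graph s j c d → c Fin.< d →
    NotSeparated (graph s) k u → NotSeparated (graph s) k w →
    (Within⁺ a b u → Within⁺ a b w) → Within⁺ c d u → Within⁺ c d w
  notSeparated-edge {a = a} {b} {c} {d} {u} {w} k-edge a<b j-edge c<d u-near w-near k-same inside
    with within⁺? c d w
  ... | yes w-inside = w-inside
  ... | no w-outside with at-end k-edge | at-end (edge-sym k-edge)
    where
    at-end : ∀ {v z} → graph s _ v z → v ≡ c ⊎ v ≡ d
    at-end {v} e with proj₁ (u-near j-edge c<d e) inside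
    ... | c≤v , v≤d with ℕ.m≤n⇒m<n∨m≡n c≤v | ℕ.m≤n⇒m<n∨m≡n v≤d
    ...   | inj₂ c≡v | _        = inj₁ (toℕ-injective (sym c≡v))
    ...   | _        | inj₂ v≡d = inj₂ (toℕ-injective v≡d)
    ...   | inj₁ c<v | inj₁ v<d = contradiction (proj₂ (w-near j-edge c<d e) c<v v<d) w-outside
  ...   | inj₁ refl | inj₂ refl = k-same inside
  ...   | inj₁ refl | inj₁ refl = contradiction refl (ℕ.<⇒≢ a<b)
  ...   | inj₂ refl | inj₂ refl = contradiction refl (ℕ.<⇒≢ a<b)
  ...   | inj₂ refl | inj₁ refl = contradiction c<d (ℕ.<-asym a<b)

  -- Of the two trails that use edge k, take the one on u's side of the edge.
  notSeparated⇒uses : ∀ {k u} → NotSeparated (graph s) k u → Uses k u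
  notSeparated⇒uses {k} {u} u-near with ascendingEdge k
  ... | a , b , e , a<b = subst (Uses k) (sym u≡w) w-uses
    where
    user : ∃[ w ] Uses k w × (Within⁺ a b w ⇔ Within⁺ a b u)
    user with within⁺? a b u
    -- After swap k, the walk standing at a is in [a, b), hence its arc is between a and b; the walk
    -- standing at b, taken in the other case, is not.
    ... | yes inside with w , eq ← state-surjective s (suc (toℕ k)) a =
      w , uses-suc (subst (λ v → graph s k v b) (sym eq) e) ,
      mk⇔ (λ _ → inside) (λ _ → to (within-late-state k e a<b ℕ.≤-refl (toℕ<n k) w)
        (subst (Within⁻ a b) (sym eq) (ℕ.≤-refl , a<b)))
    ... | no outside with w , eq ← state-surjective s (suc (toℕ k)) b =
      w , uses-suc (subst (λ v → graph s k v a) (sym eq) (edge-sym e)) ,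
      mk⇔ (λ w-inside → contradiction refl (ℕ.<⇒≢ (proj₂ (subst (Within⁻ a b) eq
              (from (within-late-state k e a<b ℕ.≤-refl (toℕ<n k) w) w-inside)))))
          (λ inside → contradiction inside outside)

    w = proj₁ user
    w-uses = proj₁ (proj₂ user)
    w⇔u = proj₂ (proj₂ user)

    same : ∀ {j c d} → graph s j c d → c Fin.< d → Within⁺ c d u ⇔ Within⁺ c d w
    same j-edge c<d = mk⇔
      (notSeparated-edge e a<b j-edge c<d u-near (uses⇒notSeparated w-uses) (from w⇔u))
      (notSeparated-edge e a<b j-edge c<d (uses⇒notSeparated w-uses) u-near (to w⇔u))

    u≡w : u ≡ w
    u≡w with <-cmp u w
    ... | tri< u<w _ _ = ⊥-elim (arcs-separated u<w same)
    ... | tri≈ _ u≡w _ = u≡w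
    ... | tri> _ _ w<u = ⊥-elim (arcs-separated w<u (λ e c<d → ⇔-sym (same e c<d)))

-- Combination of the geometric and the combinatorial descriptions.

theorem7p5 : ∀ {c ℓ₁ ℓ₂} (K : OrderedField c ℓ₁ ℓ₂) (m : ℕ) →
    (P : Plane.CirclePoints K (suc m)) →
    (s : Vec (Transposition (suc m)) m) → In𝓕 s →
    ChordDiagram.gouldenYongDual K P (graph s) ≐ dual (graph s)
theorem7p5 K zero    P s s∈𝓕 ()
theorem7p5 K (suc r) P s s∈𝓕 k u v = mk⇔
  (λ (u≢v , u-bounds , v-bounds) → u≢v , boundary⇒trail u-bounds , boundary⇒trail v-bounds)
  (λ (u≢v , u-uses , v-uses) → u≢v , trail⇒boundary u-uses , trail⇒boundary v-uses)
  where
  open Edges s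
  open Factorisation s s∈𝓕
  open Regions K P (graph s) edge-sym edge-irrefl
  open ChordDiagram K P (graph s) using (ChordOnBoundary)
  open Trails (graph s) using (TrailUses)

  boundary⇒trail : ∀ {u} → ChordOnBoundary k u → TrailUses u k
  boundary⇒trail bounds = from trailUses⇔uses
    (notSeparated⇒uses (facing⇒notSeparated (λ {e} → edge-sym {e}) (onBoundary⇒facing bounds)))

  trail⇒boundary : ∀ {u} → TrailUses u k → ChordOnBoundary k u
  trail⇒boundary uses = facing⇒onBoundary
    (notSeparated⇒facing (λ {e} → edge-sym {e}) (uses⇒notSeparated (to trailUses⇔uses uses)))
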